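{- Let $a,b$ be coprime positive integers with $(a,b)\neq(1,1)$ and let $\psi\in\mathscr{T}(a,b)$. Suppose that $a$ and $b$ are $\psi$-independent. Writing $c=a+b$, we have $$\frac{c}{\log c}\le \mathrm{rad}(abc)\cdot\frac{\|\psi\|}{\log 2}.$$
   Context: For a prime $p$, $v_p$ is the $p$-adic valuation. For a non-zero integer $n$, $\mathrm{supp}(n)$ is the set of primes dividing $n$; for a positive integer $n$, $\mathrm{rad}(n)$ is the product of the distinct primes dividing $n$. Let $\Omega$ be the free $\mathbb{Z}$-module on symbols $\xi_p$, one for each prime $p$. Define $\mathrm{d}:\mathbb{Z}\to\Omega$ by $\mathrm{d}0=0$ and $\mathrm{d}n=\sum_{p\mid n}\frac{n\,v_p(n)}{p}\,\xi_p$ for $n\ne 0$ (the coefficients are integers). For a $\mathbb{Z}$-linear map $\psi:\Omega\to\mathbb{Z}$ put $\|\psi\|=\sup_p|\psi(\xi_p)|$. Let $\mathscr{T}$ be the $\mathbb{Z}$-module of all $\mathbb{Z}$-linear $\psi:\Omega\to\mathbb{Z}$ with $\|\psi\|<\infty$. For $\psi\in\mathscr{T}$ let $\mathrm{d}^\psi=\psi\circ\mathrm{d}:\mathbb{Z}\to\mathbb{Z}$ and $\mathrm{supp}(\psi)=\{p:\psi(\xi_p)\neq0\}$. For positive integers $a,b$, $$\mathscr{T}(a,b)=\{\psi\in\mathscr{T}:\ \mathrm{supp}(\psi)\subseteq\mathrm{supp}(ab(a+b))\ \text{and}\ \mathrm{d}^\psi(a+b)=\mathrm{d}^\psi a+\mathrm{d}^\psi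 b\}.$$ Integers $a,b$ are $\psi$-independent if $W^\psi(a,b):=a\,\mathrm{d}^\psi b-b\,\mathrm{d}^\psi a\neq 0$. -}

module Defs where

open import Algebra.Module.Bundles using (Module)
import Algebra.Module.Construct.TensorUnit as TensorUnit
open import Algebra.Module.Morphism.Structures using (module ModuleMorphisms)
open import Algebra.Module.Structures.Biased using (IsModuleFromLeft)
open import Data.Empty using (⊥-elim)
open import Data.Integer.Base as ℤ using (ℤ; +_; 0ℤ; 1ℤ)
import Data.Integer.Divisibility as ℤ using (_∣_)
import Data.Integer.Properties as ℤ
open import Data.List.Base using (filter; upTo)
open import Data.Nat.ListAction using (product)
open import Data.Nat.Base as ℕ
  using (ℕ; zero; suc; z≤n; s≤s; NonZero; NonTrivial)
import Data.Nat.Divisibility as ℕ using (_∣_; _∣?_; ∣⇒≤)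
open import Data.Nat.Primality using (Prime; prime?; prime⇒nonZero)
import Data.Nat.Properties as ℕ
open import Data.Product.Base using (∃; ∃-syntax; _×_; _,_; proj₁; proj₂)
open import Data.Rational.Base as ℚ using (ℚ; 0ℚ; 1ℚ; ½)
import Data.Rational.Properties as ℚ
open import Data.Rational.Solver using (module +-*-Solver)
import Data.Rational.Unnormalised.Base as ℚᵘ
import Data.Rational.Unnormalised.Properties as ℚᵘ
open import Data.Sum.Base using (inj₁; inj₂)
open import Level using (0ℓ)
open import Relation.Binary.PropositionalEquality
open import Relation.Nullary using (Dec; yes; no; ¬_; recompute)
open import Relation.Nullary.Decidable using (_×-dec_)
open import Relation.Unary using (Pred; _⊆_)

-- The proof of primality is irrelevant, so two primes with the same value
-- are definitionally equal and may index a family.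
record ℙ : Set where
  constructor mkℙ
  field
    val      : ℕ
    .isPrime : Prime val

open ℙ public using (val)

val-prime : (p : ℙ) → Prime (val p)
val-prime (mkℙ p pr) = recompute (prime? p) pr

-- largestPower p n k is the largest e ≤ k with p ^ e ∣ n.
largestPower : ℕ → ℕ → ℕ → ℕ
largestPower p n zero = 0
largestPower p n (suc k) with (p ℕ.^ suc k) ℕ.∣? n
... | yes _ = suc k
... | no  _ = largestPower p n k

-- The search may stop at ∣ n ∣, because p ^ e ∣ n ≠ 0 forces e ≤ ∣ n ∣.
-- The value v p 0ℤ = 0 is a convention that is never used.
v : ℙ → ℤ → ℕ
v p n = largestPower (val p) ℤ.∣ n ∣ ℤ.∣ n ∣

supp : ℤ → Pred ℙ 0ℓ
supp n p = + val p ℤ.∣ n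

rad : ℕ → ℕ
rad n = product (filter (λ p → prime? p ×-dec (p ℕ.∣? n)) (upTo (suc n)))

-- The free ℤ-module on symbols ξ p: finitely supported families of
-- coefficients.  `finite` says that all coefficients at large primes vanish.

record Ω : Set where
  field
    coeff  : ℙ → ℤ
    finite : ∃[ N ] ∀ p → N ℕ.< val p → coeff p ≡ 0ℤ

open Ω public

infix  4 _≈Ω_
infixl 6 _+Ω_
infixr 7 _·Ω_
infix  8 -Ω_

_≈Ω_ : Ω → Ω → Set
x ≈Ω y = ∀ p → coeff x p ≡ coeff y p

0Ω : Ω
0Ω = record { coeff = λ _ → 0ℤ ; finite = 0 , λ _ _ → refl }

_+Ω_ : Ω → Ω → Ω
x +Ω y = record
  { coeff  = λ p → coeff x p ℤ.+ coeff y p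
  ; finite = let (M , f) = finite x ; (N , g) = finite y in
      M ℕ.⊔ N , λ p lt → cong₂ ℤ._+_ (f p (ℕ.m⊔n<o⇒m<o M N lt))
                                      (g p (ℕ.m⊔n<o⇒n<o M N lt))
  }

-Ω_ : Ω → Ω
-Ω x = record
  { coeff  = λ p → ℤ.- coeff x p
  ; finite = let (M , f) = finite x in M , λ p lt → cong ℤ.-_ (f p lt)
  }

_·Ω_ : ℤ → Ω → Ω
k ·Ω x = record
  { coeff  = λ p → k ℤ.* coeff x p
  ; finite = let (M , f) = finite x in
      M , λ p lt → trans (cong (k ℤ.*_) (f p lt)) (ℤ.*-zeroʳ k)
  }

Ω-module : Module ℤ.+-*-commutativeRing 0ℓ 0ℓ
Ω-module = record
  { Carrierᴹ = Ω ; _≈ᴹ_ = _≈Ω_ ; _+ᴹ_ = _+Ω_ ; _*ₗ_ = _·Ω_ ; 0ᴹ = 0Ω ; -ᴹ_ = -Ω_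
  ; isModule = IsModuleFromLeft.isModule (record { isLeftModule = record
      { isLeftSemimodule = record
          { +ᴹ-isCommutativeMonoid = record
              { isMonoid = record
                  { isSemigroup = record
                      { isMagma = record
                          { isEquivalence = record
                              { refl  = λ _ → refl
                              ; sym   = λ e p → sym (e p)
                              ; trans = λ e f p → trans (e p) (f p)
                              }
                          ; ∙-cong = λ e f p → cong₂ ℤ._+_ (e p) (f p)
                          }
                      ; assoc = λ x y z p → ℤ.+-assoc (coeff x p) (coeff y p) (coeff z p)
                      }
                  ; identity = (λ x p → ℤ.+-identityˡ (coeff x p))
                             , (λ x p → ℤ.+-identityʳ (coeff x p))
                  }
              ; comm = λ x y p → ℤ.+-comm (coeff x p) (coeff y p)
              }
          ; isPreleftSemimodule = record
              { *ₗ-cong      = λ e f p → cong₂ ℤ._*_ e (f p)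
              ; *ₗ-zeroˡ     = λ x p → ℤ.*-zeroˡ (coeff x p)
              ; *ₗ-distribʳ  = λ x k l p → ℤ.*-distribʳ-+ (coeff x p) k l
              ; *ₗ-identityˡ = λ x p → ℤ.*-identityˡ (coeff x p)
              ; *ₗ-assoc     = λ k l x p → ℤ.*-assoc k l (coeff x p)
              ; *ₗ-zeroʳ     = λ k p → ℤ.*-zeroʳ k
              ; *ₗ-distribˡ  = λ k x y p → ℤ.*-distribˡ-+ k (coeff x p) (coeff y p)
              }
          }
      ; -ᴹ‿cong    = λ e p → cong ℤ.-_ (e p)
      ; -ᴹ‿inverse = (λ x p → ℤ.+-inverseˡ (coeff x p))
                   , (λ x p → ℤ.+-inverseʳ (coeff x p))
      } })
  }

ℤ-module : Module ℤ.+-*-commutativeRing 0ℓ 0ℓ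
ℤ-module = TensorUnit.⟨module⟩

open ModuleMorphisms (Module.rawModule Ω-module) (Module.rawModule ℤ-module)
  public using (IsModuleHomomorphism)

δ : ∀ {m n : ℕ} → Dec (m ≡ n) → ℤ
δ (yes _) = 1ℤ
δ (no  _) = 0ℤ

ξ : ℙ → Ω
ξ p = record
  { coeff  = λ q → δ (val p ℕ.≟ val q)
  ; finite = val p , λ q lt → off q lt (val p ℕ.≟ val q)
  }
  where
  off : ∀ q → val p ℕ.< val q → (e : Dec (val p ≡ val q)) → δ e ≡ 0ℤ
  off q lt (yes e) = ⊥-elim (ℕ.<⇒≢ lt e)
  off q lt (no  _) = refl

-- n · v p n / p.  The division is exact: either p ∣ n or v p n = 0.  In
-- particular the coefficient vanishes for p ∤ n, and every coefficient of
-- d 0 is 0.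
dCoeff : ℤ → ℙ → ℤ
dCoeff n P@(mkℙ p pr) = ℤ._/ℕ_ (n ℤ.* + v P n) p {{prime⇒nonZero pr}}

private
  n/p≡0 : ∀ p .{{_ : NonZero p}} → 0ℤ ℤ./ℕ p ≡ 0ℤ
  n/p≡0 (suc _) = refl

  largestPower-big : ∀ p n .{{_ : NonZero n}} → n ℕ.< p → ∀ k → largestPower p n k ≡ 0
  largestPower-big p n n<p zero = refl
  largestPower-big p n n<p (suc k) with (p ℕ.^ suc k) ℕ.∣? n
  ... | no _     = largestPower-big p n n<p k
  ... | yes p^∣n = ⊥-elim (ℕ.<⇒≱ n<p (ℕ.≤-trans
          (ℕ.m≤m*n p (p ℕ.^ k) {{ℕ.m^n≢0 p k {{ℕ.>-nonZero (ℕ.≤-<-trans z≤n n<p)}}}})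
          (ℕ.∣⇒≤ p^∣n)))

  n*v≡0 : ∀ n p → ℤ.∣ n ∣ ℕ.< val p → n ℤ.* + v p n ≡ 0ℤ
  n*v≡0 (+ zero)      p lt = refl
  n*v≡0 n@(ℤ.+[1+ m ]) p lt = trans
    (cong (λ e → n ℤ.* + e) (largestPower-big (val p) (suc m) lt (suc m))) (ℤ.*-zeroʳ n)
  n*v≡0 n@(ℤ.-[1+ m ]) p lt = trans
    (cong (λ e → n ℤ.* + e) (largestPower-big (val p) (suc m) lt (suc m))) (ℤ.*-zeroʳ n)

d : ℤ → Ω
d n = record
  { coeff  = dCoeff n
  ; finite = ℤ.∣ n ∣ , λ where
      P@(mkℙ p pr) lt → trans
        (cong (λ z → ℤ._/ℕ_ z p {{prime⇒nonZero pr}}) (n*v≡0 n P lt))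
        (n/p≡0 p {{prime⇒nonZero pr}})
  }

record 𝒯 : Set where
  field
    ⟦_⟧     : Ω → ℤ
    linear  : IsModuleHomomorphism ⟦_⟧
    bounded : ∃[ B ] ∀ p → ℤ.∣ ⟦ ξ p ⟧ ∣ ℕ.≤ B

open 𝒯 public

d^ : 𝒯 → ℤ → ℤ
d^ ψ n = ⟦ ψ ⟧ (d n)

suppψ : 𝒯 → Pred ℙ 0ℓ
suppψ ψ p = ⟦ ψ ⟧ (ξ p) ≢ 0ℤ

infix 4 _∈𝒯[_,_]

record _∈𝒯[_,_] (ψ : 𝒯) (a b : ℕ) : Set where
  field
    supp⊆    : suppψ ψ ⊆ supp (+ (a ℕ.* b ℕ.* (a ℕ.+ b)))
    additive : d^ ψ (+ a ℤ.+ + b) ≡ d^ ψ (+ a) ℤ.+ d^ ψ (+ b)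

open _∈𝒯[_,_] public

W : 𝒯 → ℤ → ℤ → ℤ
W ψ a b = a ℤ.* d^ ψ b ℤ.- b ℤ.* d^ ψ a

Independent : 𝒯 → ℤ → ℤ → Set
Independent ψ a b = W ψ a b ≢ 0ℤ

-- A supremum of a bounded family of naturals indexed by ℙ, taken in the
-- reals, is attained, hence a natural number.
IsSup : (ℙ → ℕ) → ℕ → Set
IsSup f K = (∀ p → f p ℕ.≤ K) × (∀ M → (∀ p → f p ℕ.≤ M) → K ℕ.≤ M)

private
  atPrime : (ℙ → ℕ) → (k : ℕ) → Dec (Prime k) → ℕ
  atPrime f k (yes pr) = f (mkℙ k pr)
  atPrime f k (no  _)  = 0

  maxUpTo : (ℙ → ℕ) → ℕ → ℕ
  maxUpTo f zero    = 0
  maxUpTo f (suc n) = atPrime f (suc n) (prime? (suc n)) ℕ.⊔ maxUpTo f n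

  maxUpTo-least : ∀ f M → (∀ p → f p ℕ.≤ M) → ∀ n → maxUpTo f n ℕ.≤ M
  maxUpTo-least f M f≤M zero = z≤n
  maxUpTo-least f M f≤M (suc n) =
    ℕ.⊔-lub (here (prime? (suc n))) (maxUpTo-least f M f≤M n)
    where
    here : (pr? : Dec (Prime (suc n))) → atPrime f (suc n) pr? ℕ.≤ M
    here (yes pr) = f≤M _
    here (no  _)  = z≤n

  atPrime-≡ : ∀ f k .(pr : Prime k) (pr? : Dec (Prime k)) → f (mkℙ k pr) ≡ atPrime f k pr?
  atPrime-≡ f k pr (yes _)  = refl
  atPrime-≡ f k pr (no ¬pr) = ⊥-elim (¬pr (recompute (prime? k) pr))

  maxUpTo-upper : ∀ f n k .(pr : Prime k) → 0 ℕ.< k → k ℕ.≤ n → f (mkℙ k pr) ℕ.≤ maxUpTo f n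
  maxUpTo-upper f zero    k pr 0<k k≤n = ⊥-elim (ℕ.<⇒≱ 0<k k≤n)
  maxUpTo-upper f (suc n) k pr 0<k k≤n with k ℕ.≟ suc n
  ... | yes refl = ℕ.≤-trans (ℕ.≤-reflexive (atPrime-≡ f k pr (prime? k))) (ℕ.m≤m⊔n _ _)
  ... | no k≢n   = ℕ.≤-trans
    (maxUpTo-upper f n k pr 0<k (ℕ.s≤s⁻¹ (ℕ.≤∧≢⇒< k≤n k≢n))) (ℕ.m≤n⊔m _ _)

-- For a general ψ the supremum exists only classically; on 𝒯(a,b) the
-- support is finite and it can be computed.
supNorm : ∀ {ψ a b} .{{_ : NonZero a}} .{{_ : NonZero b}} → ψ ∈𝒯[ a , b ] →
          ∃[ K ] IsSup (λ p → ℤ.∣ ⟦ ψ ⟧ (ξ p) ∣) K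
supNorm {ψ} {a} {b} ψ∈ = maxUpTo f n , upper , λ M f≤M → maxUpTo-least f M f≤M n
  where
  n : ℕ
  n = a ℕ.* b ℕ.* (a ℕ.+ b)
  f : ℙ → ℕ
  f p = ℤ.∣ ⟦ ψ ⟧ (ξ p) ∣
  instance
    n≢0 : NonZero n
    n≢0 = ℕ.m*n≢0 (a ℕ.* b) (a ℕ.+ b) {{ℕ.m*n≢0 a b}}
            {{ℕ.>-nonZero (ℕ.<-≤-trans (ℕ.>-nonZero⁻¹ a) (ℕ.m≤m+n a b))}}
  upper : ∀ p → f p ℕ.≤ maxUpTo f n
  upper P@(mkℙ p pr) with ⟦ ψ ⟧ (ξ P) ℤ.≟ 0ℤ
  ... | yes ψp≡0 = subst (ℕ._≤ maxUpTo f n) (cong ℤ.∣_∣ (sym ψp≡0)) z≤n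
  ... | no  ψp≢0 = maxUpTo-upper f n p pr
    (ℕ.>-nonZero⁻¹ p {{prime⇒nonZero pr}}) (ℕ.∣⇒≤ (supp⊆ ψ∈ {P} ψp≢0))

‖_‖ : ∀ {ψ a b} .{{_ : NonZero a}} .{{_ : NonZero b}} → ψ ∈𝒯[ a , b ] → ℕ
‖ ψ∈ ‖ = proj₁ (supNorm ψ∈)

record ℝ : Set where
  no-eta-equality
  field
    seq    : ℕ → ℚ
    cauchy : ∀ ε → 0ℚ ℚ.< ε →
             ∃[ N ] ∀ m n → N ℕ.≤ m → N ℕ.≤ n → ℚ.∣ seq m ℚ.- seq n ∣ ℚ.≤ ε

open ℝ public

infix  4 _≤ᴿ_
infixl 7 _*ᴿ_ _/ᴿ_

_≤ᴿ_ : ℝ → ℝ → Set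
x ≤ᴿ y = ∀ ε → 0ℚ ℚ.< ε → ∃[ N ] ∀ n → N ℕ.≤ n → seq x n ℚ.≤ seq y n ℚ.+ ε

record Positive (x : ℝ) : Set where
  field
    bound      : ℚ
    0<bound    : 0ℚ ℚ.< bound
    from       : ℕ
    eventually : ∀ n → from ℕ.≤ n → bound ℚ.≤ seq x n

open Positive public

fromℚ : ℚ → ℝ
fromℚ q .seq    _     = q
fromℚ q .cauchy ε 0<ε = 0 , λ _ _ _ _ →
  subst (λ r → ℚ.∣ r ∣ ℚ.≤ ε) (sym (ℚ.+-inverseʳ q)) (ℚ.<⇒≤ 0<ε)

fromℕ : ℕ → ℝ
fromℕ n = fromℚ (+ n ℚ./ 1)

private
  open ℚ.≤-Reasoning
  module S = +-*-Solver

  nn : ∀ {p} → 0ℚ ℚ.≤ p → ℚ.NonNegative p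
  nn = ℚ.nonNegative

  *-mono : ∀ {p q r s} → 0ℚ ℚ.≤ r → 0ℚ ℚ.≤ q → p ℚ.≤ q → r ℚ.≤ s →
           p ℚ.* r ℚ.≤ q ℚ.* s
  *-mono {p} {q} {r} {s} 0≤r 0≤q p≤q r≤s = ℚ.≤-trans
    (ℚ.*-monoʳ-≤-nonNeg r {{nn 0≤r}} p≤q) (ℚ.*-monoˡ-≤-nonNeg q {{nn 0≤q}} r≤s)

  inverse : (q : ℚ) → 0ℚ ℚ.< q → ∃[ r ] 0ℚ ℚ.< r × q ℚ.* r ≡ 1ℚ
  inverse q 0<q = r , ℚ.positive⁻¹ r {{ℚ.1/pos⇒pos q}} , ℚ.*-inverseʳ q {{q≢0}}
    where
    instance
      q+ : ℚ.Positive q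
      q+ = ℚ.positive 0<q
    q≢0 : ℚ.NonZero q
    q≢0 = ℚ.pos⇒nonZero q
    r : ℚ
    r = ℚ.1/_ q {{q≢0}}

  0<* : ∀ {p q} → 0ℚ ℚ.< p → 0ℚ ℚ.< q → 0ℚ ℚ.< p ℚ.* q
  0<* {p} {q} 0<p 0<q = ℚ.positive⁻¹ _
    {{ℚ.pos*pos⇒pos p {{ℚ.positive 0<p}} q {{ℚ.positive 0<q}}}}

  near : ∀ {p q e} → p ℚ.≤ q ℚ.+ e → q ℚ.≤ p ℚ.+ e → ℚ.∣ p ℚ.- q ∣ ℚ.≤ e
  near {p} {q} {e} p≤ q≤ with ℚ.∣p∣≡p∨∣p∣≡-p (p ℚ.- q)
  ... | inj₁ eq = begin
    ℚ.∣ p ℚ.- q ∣       ≡⟨ eq ⟩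
    p ℚ.- q             ≤⟨ ℚ.+-monoˡ-≤ (ℚ.- q) p≤ ⟩
    q ℚ.+ e ℚ.- q       ≡⟨ S.solve 2 (λ q e → q S.:+ e S.:+ (S.:- q) S.:= e) refl q e ⟩
    e                   ∎
  ... | inj₂ eq = begin
    ℚ.∣ p ℚ.- q ∣       ≡⟨ eq ⟩
    ℚ.- (p ℚ.- q)       ≡⟨ S.solve 2 (λ p q → S.:- (p S.:+ (S.:- q)) S.:= q S.:+ (S.:- p)) refl p q ⟩
    q ℚ.- p             ≤⟨ ℚ.+-monoˡ-≤ (ℚ.- p) q≤ ⟩
    p ℚ.+ e ℚ.- p       ≡⟨ S.solve 2 (λ p e → p S.:+ e S.:+ (S.:- p) S.:= e) refl p e ⟩
    e                   ∎

  bounded-seq : (x : ℝ) → ∃[ B ] (0ℚ ℚ.< B) × ∃[ N ] ∀ n → N ℕ.≤ n → ℚ.∣ seq x n ∣ ℚ.≤ B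
  bounded-seq x with cauchy x 1ℚ (ℚ.positive⁻¹ 1ℚ)
  ... | N , c = 1ℚ ℚ.+ ℚ.∣ xN ∣
              , ℚ.<-≤-trans (ℚ.positive⁻¹ 1ℚ) (begin
                  1ℚ                 ≡⟨ ℚ.+-identityʳ 1ℚ ⟨
                  1ℚ ℚ.+ 0ℚ          ≤⟨ ℚ.+-monoʳ-≤ 1ℚ (ℚ.0≤∣p∣ xN) ⟩
                  1ℚ ℚ.+ ℚ.∣ xN ∣    ∎)
              , N , λ n N≤n → begin
                  ℚ.∣ seq x n ∣                      ≡⟨ cong ℚ.∣_∣ (S.solve 2 (λ a b → a S.:= (a S.:+ (S.:- b)) S.:+ b) refl (seq x n) xN) ⟩
                  ℚ.∣ (seq x n ℚ.- xN) ℚ.+ xN ∣      ≤⟨ ℚ.∣p+q∣≤∣p∣+∣q∣ (seq x n ℚ.- xN) xN ⟩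
                  ℚ.∣ seq x n ℚ.- xN ∣ ℚ.+ ℚ.∣ xN ∣  ≤⟨ ℚ.+-monoˡ-≤ ℚ.∣ xN ∣ (c n N N≤n ℕ.≤-refl) ⟩
                  1ℚ ℚ.+ ℚ.∣ xN ∣                    ∎
    where
    xN : ℚ
    xN = seq x N

private
  *-estimate : ∀ {A B η} a b c e → 0ℚ ℚ.≤ A → 0ℚ ℚ.≤ η →
    ℚ.∣ a ∣ ℚ.≤ A → ℚ.∣ e ∣ ℚ.≤ B → ℚ.∣ c ℚ.- e ∣ ℚ.≤ η → ℚ.∣ a ℚ.- b ∣ ℚ.≤ η →
    ℚ.∣ a ℚ.* c ℚ.- b ℚ.* e ∣ ℚ.≤ A ℚ.* η ℚ.+ η ℚ.* B
  *-estimate {A} {B} {η} a b c e 0≤A 0≤η a≤A e≤B ce≤η ab≤η = begin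
    ℚ.∣ a ℚ.* c ℚ.- b ℚ.* e ∣
      ≡⟨ cong ℚ.∣_∣ (S.solve 4 (λ a b c e →
           a S.:* c S.:+ (S.:- (b S.:* e)) S.:=
           a S.:* (c S.:+ (S.:- e)) S.:+ (a S.:+ (S.:- b)) S.:* e) refl a b c e) ⟩
    ℚ.∣ a ℚ.* (c ℚ.- e) ℚ.+ (a ℚ.- b) ℚ.* e ∣
      ≤⟨ ℚ.∣p+q∣≤∣p∣+∣q∣ (a ℚ.* (c ℚ.- e)) ((a ℚ.- b) ℚ.* e) ⟩
    ℚ.∣ a ℚ.* (c ℚ.- e) ∣ ℚ.+ ℚ.∣ (a ℚ.- b) ℚ.* e ∣
      ≡⟨ cong₂ ℚ._+_ (ℚ.∣p*q∣≡∣p∣*∣q∣ a (c ℚ.- e)) (ℚ.∣p*q∣≡∣p∣*∣q∣ (a ℚ.- b) e) ⟩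
    ℚ.∣ a ∣ ℚ.* ℚ.∣ c ℚ.- e ∣ ℚ.+ ℚ.∣ a ℚ.- b ∣ ℚ.* ℚ.∣ e ∣
      ≤⟨ ℚ.+-mono-≤ (*-mono (ℚ.0≤∣p∣ (c ℚ.- e)) 0≤A a≤A ce≤η)
                    (*-mono (ℚ.0≤∣p∣ e) 0≤η ab≤η e≤B) ⟩
    A ℚ.* η ℚ.+ η ℚ.* B ∎

  *-rescale : ∀ A B ε r → (A ℚ.+ B) ℚ.* r ≡ 1ℚ →
    A ℚ.* (ε ℚ.* r) ℚ.+ (ε ℚ.* r) ℚ.* B ≡ ε
  *-rescale A B ε r eq = begin-equality
    A ℚ.* (ε ℚ.* r) ℚ.+ (ε ℚ.* r) ℚ.* B
      ≡⟨ S.solve 4 (λ A B ε r → A S.:* (ε S.:* r) S.:+ (ε S.:* r) S.:* B S.:=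
           ε S.:* ((A S.:+ B) S.:* r)) refl A B ε r ⟩
    ε ℚ.* ((A ℚ.+ B) ℚ.* r)
      ≡⟨ cong (ε ℚ.*_) eq ⟩
    ε ℚ.* 1ℚ
      ≡⟨ ℚ.*-identityʳ ε ⟩
    ε ∎

_*ᴿ_ : ℝ → ℝ → ℝ
(x *ᴿ y) .seq n = seq x n ℚ.* seq y n
(x *ᴿ y) .cauchy ε 0<ε =
    let (A , 0<A , N₁ , x≤A) = bounded-seq x
        (B , 0<B , N₂ , y≤B) = bounded-seq y
        (r , 0<r , [A+B]r≡1) = inverse (A ℚ.+ B) (ℚ.+-mono-< 0<A 0<B)
        0<η = 0<* 0<ε 0<r
        (N₃ , cx) = cauchy x (ε ℚ.* r) 0<η
        (N₄ , cy) = cauchy y (ε ℚ.* r) 0<η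
        L = N₁ ℕ.⊔ N₂
        R = N₃ ℕ.⊔ N₄
    in L ℕ.⊔ R , λ m n N≤m N≤n →
    let L≤m = ℕ.m⊔n≤o⇒m≤o L R N≤m
        L≤n = ℕ.m⊔n≤o⇒m≤o L R N≤n
        R≤m = ℕ.m⊔n≤o⇒n≤o L R N≤m
        R≤n = ℕ.m⊔n≤o⇒n≤o L R N≤n
    in ℚ.≤-trans
      (*-estimate (seq x m) (seq x n) (seq y m) (seq y n) (ℚ.<⇒≤ 0<A) (ℚ.<⇒≤ 0<η)
        (x≤A m (ℕ.m⊔n≤o⇒m≤o N₁ N₂ L≤m))
        (y≤B n (ℕ.m⊔n≤o⇒n≤o N₁ N₂ L≤n))
        (cy m n (ℕ.m⊔n≤o⇒n≤o N₃ N₄ R≤m) (ℕ.m⊔n≤o⇒n≤o N₃ N₄ R≤n))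
        (cx m n (ℕ.m⊔n≤o⇒m≤o N₃ N₄ R≤m) (ℕ.m⊔n≤o⇒m≤o N₃ N₄ R≤n)))
      (ℚ.≤-reflexive (*-rescale A B ε r [A+B]r≡1))

-- The reciprocal of a rational, with the junk value 0 at 0.
recip : ℚ → ℚ
recip q with q ℚ.≟ 0ℚ
... | yes _   = 0ℚ
... | no  q≢0 = ℚ.1/_ q {{ℚ.≢-nonZero q≢0}}

recip-inverse : ∀ {q} → 0ℚ ℚ.< q → q ℚ.* recip q ≡ 1ℚ
recip-inverse {q} 0<q with q ℚ.≟ 0ℚ
... | yes q≡0 = ⊥-elim (ℚ.<⇒≢ 0<q (sym q≡0))
... | no  q≢0 = ℚ.*-inverseʳ q {{ℚ.≢-nonZero q≢0}}

recip-positive : ∀ {q} → 0ℚ ℚ.< q → 0ℚ ℚ.< recip q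
recip-positive {q} 0<q with q ℚ.≟ 0ℚ
... | yes q≡0 = ⊥-elim (ℚ.<⇒≢ 0<q (sym q≡0))
... | no  q≢0 = ℚ.positive⁻¹ _ {{ℚ.1/pos⇒pos q {{ℚ.positive 0<q}}}}

private
  recip-anti : ∀ {p q} → 0ℚ ℚ.< p → p ℚ.≤ q → recip q ℚ.≤ recip p
  recip-anti {p} {q} 0<p p≤q = begin
    recip q                       ≡⟨ ℚ.*-identityʳ (recip q) ⟨
    recip q ℚ.* 1ℚ                ≡⟨ cong (recip q ℚ.*_) (recip-inverse 0<p) ⟨
    recip q ℚ.* (p ℚ.* recip p)   ≤⟨ ℚ.*-monoˡ-≤-nonNeg (recip q) {{nn (ℚ.<⇒≤ (recip-positive 0<q))}}
                                       (ℚ.*-monoʳ-≤-nonNeg (recip p) {{nn (ℚ.<⇒≤ (recip-positive 0<p))}} p≤q) ⟩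
    recip q ℚ.* (q ℚ.* recip p)   ≡⟨ S.solve 3 (λ a b c → a S.:* (b S.:* c) S.:= (b S.:* a) S.:* c) refl (recip q) q (recip p) ⟩
    (q ℚ.* recip q) ℚ.* recip p   ≡⟨ cong (ℚ._* recip p) (recip-inverse 0<q) ⟩
    1ℚ ℚ.* recip p                ≡⟨ ℚ.*-identityˡ (recip p) ⟩
    recip p                       ∎
    where
    0<q : 0ℚ ℚ.< q
    0<q = ℚ.<-≤-trans 0<p p≤q

  recip-diff : ∀ {p q} → 0ℚ ℚ.< p → 0ℚ ℚ.< q →
               recip p ℚ.- recip q ≡ (q ℚ.- p) ℚ.* (recip p ℚ.* recip q)
  recip-diff {p} {q} 0<p 0<q = sym (begin-equality
    (q ℚ.- p) ℚ.* (recip p ℚ.* recip q)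
      ≡⟨ S.solve 4 (λ p q r s → (q S.:+ (S.:- p)) S.:* (r S.:* s) S.:=
           r S.:* (q S.:* s) S.:+ (S.:- ((p S.:* r) S.:* s))) refl p q (recip p) (recip q) ⟩
    recip p ℚ.* (q ℚ.* recip q) ℚ.- (p ℚ.* recip p) ℚ.* recip q
      ≡⟨ cong₂ (λ u w → recip p ℚ.* u ℚ.- w ℚ.* recip q) (recip-inverse 0<q) (recip-inverse 0<p) ⟩
    recip p ℚ.* 1ℚ ℚ.- 1ℚ ℚ.* recip q
      ≡⟨ cong₂ ℚ._-_ (ℚ.*-identityʳ (recip p)) (ℚ.*-identityˡ (recip q)) ⟩
    recip p ℚ.- recip q ∎)

private
  recip-estimate : ∀ {β ε} p q → 0ℚ ℚ.< β → 0ℚ ℚ.< ε → β ℚ.≤ p → β ℚ.≤ q →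
    ℚ.∣ q ℚ.- p ∣ ℚ.≤ ε ℚ.* (β ℚ.* β) → ℚ.∣ recip p ℚ.- recip q ∣ ℚ.≤ ε
  recip-estimate {β} {ε} p q 0<β 0<ε β≤p β≤q qp≤ = begin
    ℚ.∣ recip p ℚ.- recip q ∣
      ≡⟨ cong ℚ.∣_∣ (recip-diff 0<p 0<q) ⟩
    ℚ.∣ (q ℚ.- p) ℚ.* (recip p ℚ.* recip q) ∣
      ≡⟨ ℚ.∣p*q∣≡∣p∣*∣q∣ (q ℚ.- p) (recip p ℚ.* recip q) ⟩
    ℚ.∣ q ℚ.- p ∣ ℚ.* ℚ.∣ recip p ℚ.* recip q ∣
      ≡⟨ cong (ℚ.∣ q ℚ.- p ∣ ℚ.*_) (ℚ.0≤p⇒∣p∣≡p 0≤rprq) ⟩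
    ℚ.∣ q ℚ.- p ∣ ℚ.* (recip p ℚ.* recip q)
      ≤⟨ *-mono 0≤rprq (ℚ.<⇒≤ (0<* 0<ε (0<* 0<β 0<β))) qp≤
           (*-mono (ℚ.<⇒≤ (recip-positive 0<q)) (ℚ.<⇒≤ (recip-positive 0<β))
             (recip-anti 0<β β≤p) (recip-anti 0<β β≤q)) ⟩
    (ε ℚ.* (β ℚ.* β)) ℚ.* (recip β ℚ.* recip β)
      ≡⟨ S.solve 3 (λ ε b r → (ε S.:* (b S.:* b)) S.:* (r S.:* r) S.:=
           ε S.:* ((b S.:* r) S.:* (b S.:* r))) refl ε β (recip β) ⟩
    ε ℚ.* ((β ℚ.* recip β) ℚ.* (β ℚ.* recip β))
      ≡⟨ cong (λ u → ε ℚ.* (u ℚ.* u)) (recip-inverse 0<β) ⟩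
    ε ℚ.* 1ℚ
      ≡⟨ ℚ.*-identityʳ ε ⟩
    ε ∎
    where
    0<p : 0ℚ ℚ.< p
    0<p = ℚ.<-≤-trans 0<β β≤p
    0<q : 0ℚ ℚ.< q
    0<q = ℚ.<-≤-trans 0<β β≤q
    0≤rprq : 0ℚ ℚ.≤ recip p ℚ.* recip q
    0≤rprq = ℚ.<⇒≤ (0<* (recip-positive 0<p) (recip-positive 0<q))

-- From some index on, the terms of a positive real are bounded away from 0,
-- so the termwise reciprocal represents its inverse.
1/ᴿ_ : (x : ℝ) → {{Positive x}} → ℝ
(1/ᴿ x) .seq n = recip (seq x n)
1/ᴿ_ x {{x+}} .cauchy ε 0<ε =
    let β = bound x+
        0<β = 0<bound x+
        (N , c) = cauchy x (ε ℚ.* (β ℚ.* β)) (0<* 0<ε (0<* 0<β 0<β))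
    in from x+ ℕ.⊔ N , λ m n N≤m N≤n →
      recip-estimate (seq x m) (seq x n) 0<β 0<ε
        (eventually x+ m (ℕ.m⊔n≤o⇒m≤o (from x+) N N≤m))
        (eventually x+ n (ℕ.m⊔n≤o⇒m≤o (from x+) N N≤n))
        (c n m (ℕ.m⊔n≤o⇒n≤o (from x+) N N≤n) (ℕ.m⊔n≤o⇒n≤o (from x+) N N≤m))

_/ᴿ_ : ℝ → (y : ℝ) → {{Positive y}} → ℝ
x /ᴿ y = x *ᴿ (1/ᴿ y)

Σ< : ℕ → (ℕ → ℚ) → ℚ
Σ< zero    f = 0ℚ
Σ< (suc n) f = Σ< n f ℚ.+ f n

1/[1+_] : ℕ → ℚ
1/[1+ k ] = + 1 ℚ./ suc k

-- log n = ∫₁ⁿ dx/x.  With N = k + 1, the k-th term is the Riemann sum of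
-- this integral for mesh 1/N and right endpoints,
--   Σ_{j=1}^{(n-1)N} (1/N) · 1/(1 + j/N)  =  Σ_{j=1}^{(n-1)N} 1/(N + j).
-- At n = 0 the sum is empty; this value is never used.
logSum : ℕ → ℕ → ℚ
logSum n k = Σ< (ℕ.pred n ℕ.* suc k) (λ j → 1/[1+ suc k ℕ.+ j ])

0<1/[1+_] : ∀ k → 0ℚ ℚ.< 1/[1+ k ]
0<1/[1+ k ] = ℚ.positive⁻¹ _ {{ℚ.normalize-pos 1 (suc k)}}

1/[1+]-anti : ∀ {j k} → j ℕ.≤ k → 1/[1+ k ] ℚ.≤ 1/[1+ j ]
1/[1+]-anti {j} {k} j≤k = ℚ.toℚᵘ-cancel-≤ (ℚᵘ.≤-trans
  (ℚᵘ.≤-reflexive (ℚ.toℚᵘ-fromℚᵘ (ℚᵘ.mkℚᵘ (+ 1) k)))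
  (ℚᵘ.≤-trans
    (ℚᵘ.*≤* (ℤ.*-monoˡ-≤-nonNeg (+ 1) (ℤ.+≤+ (s≤s j≤k))))
    (ℚᵘ.≤-reflexive (ℚᵘ.≃-sym (ℚ.toℚᵘ-fromℚᵘ (ℚᵘ.mkℚᵘ (+ 1) j))))))

/1-suc : ∀ n → + suc n ℚ./ 1 ≡ + n ℚ./ 1 ℚ.+ 1ℚ
/1-suc n = ℚ.toℚᵘ-injective (ℚᵘ.≃-trans (ℚ.toℚᵘ-fromℚᵘ (ℚᵘ.mkℚᵘ (+ suc n) 0))
  (ℚᵘ.≃-sym (ℚᵘ.≃-trans (ℚ.toℚᵘ-homo-+ (+ n ℚ./ 1) 1ℚ)
    (ℚᵘ.≃-trans (ℚᵘ.+-congˡ (ℚ.toℚᵘ 1ℚ) (ℚ.toℚᵘ-fromℚᵘ (ℚᵘ.mkℚᵘ (+ n) 0)))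
      (ℚᵘ.*≡* (cong (ℤ._* + 1) (trans (cong (ℤ._+ + 1) (ℤ.*-identityʳ (+ n)))
        (cong +_ (ℕ.+-comm n 1)))))))))

*-1/[1+] : ∀ m k → (+ suc m ℚ./ 1) ℚ.* 1/[1+ k ℕ.+ m ℕ.* suc k ] ≡ 1/[1+ k ]
*-1/[1+] m k = ℚ.toℚᵘ-injective (ℚᵘ.≃-trans
  (ℚ.toℚᵘ-homo-* (+ suc m ℚ./ 1) 1/[1+ k ℕ.+ m ℕ.* suc k ])
  (ℚᵘ.≃-trans
    (ℚᵘ.*-cong (ℚ.toℚᵘ-fromℚᵘ (ℚᵘ.mkℚᵘ (+ suc m) 0))
               (ℚ.toℚᵘ-fromℚᵘ (ℚᵘ.mkℚᵘ (+ 1) (k ℕ.+ m ℕ.* suc k))))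
    (ℚᵘ.≃-trans
      (ℚᵘ.*≡* (trans (cong (ℤ._* + suc k) (ℤ.*-identityʳ (+ suc m)))
        (trans (sym (ℤ.pos-* (suc m) (suc k)))
          (trans (cong +_ (sym (ℕ.+-identityʳ (suc m ℕ.* suc k))))
            (sym (ℤ.*-identityˡ _))))))
      (ℚᵘ.≃-sym (ℚ.toℚᵘ-fromℚᵘ (ℚᵘ.mkℚᵘ (+ 1) k))))))

Σ<-upper : ∀ n {f q} → (∀ j → j ℕ.< n → f j ℚ.≤ q) → Σ< n f ℚ.≤ (+ n ℚ./ 1) ℚ.* q
Σ<-upper zero    {q = q} _ = ℚ.≤-reflexive (sym (ℚ.*-zeroˡ q))
Σ<-upper (suc n) {f} {q} h = begin
  Σ< n f ℚ.+ f n                     ≤⟨ ℚ.+-mono-≤ (Σ<-upper n (λ j lt → h j (ℕ.m<n⇒m<1+n lt)))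
                                                    (h n ℕ.≤-refl) ⟩
  (+ n ℚ./ 1) ℚ.* q ℚ.+ q            ≡⟨ cong ((+ n ℚ./ 1) ℚ.* q ℚ.+_) (ℚ.*-identityˡ q) ⟨
  (+ n ℚ./ 1) ℚ.* q ℚ.+ 1ℚ ℚ.* q     ≡⟨ ℚ.*-distribʳ-+ q (+ n ℚ./ 1) 1ℚ ⟨
  (+ n ℚ./ 1 ℚ.+ 1ℚ) ℚ.* q           ≡⟨ cong (ℚ._* q) (/1-suc n) ⟨
  (+ suc n ℚ./ 1) ℚ.* q              ∎

Σ<-lower : ∀ n {f q} → (∀ j → j ℕ.< n → q ℚ.≤ f j) → (+ n ℚ./ 1) ℚ.* q ℚ.≤ Σ< n f
Σ<-lower zero    {q = q} _ = ℚ.≤-reflexive (ℚ.*-zeroˡ q)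
Σ<-lower (suc n) {f} {q} h = begin
  (+ suc n ℚ./ 1) ℚ.* q              ≡⟨ cong (ℚ._* q) (/1-suc n) ⟩
  (+ n ℚ./ 1 ℚ.+ 1ℚ) ℚ.* q           ≡⟨ ℚ.*-distribʳ-+ q (+ n ℚ./ 1) 1ℚ ⟩
  (+ n ℚ./ 1) ℚ.* q ℚ.+ 1ℚ ℚ.* q     ≡⟨ cong ((+ n ℚ./ 1) ℚ.* q ℚ.+_) (ℚ.*-identityˡ q) ⟩
  (+ n ℚ./ 1) ℚ.* q ℚ.+ q            ≤⟨ ℚ.+-mono-≤ (Σ<-lower n (λ j lt → h j (ℕ.m<n⇒m<1+n lt)))
                                                    (h n ℕ.≤-refl) ⟩
  Σ< n f ℚ.+ f n                     ∎

harmonic : ℕ → ℚ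
harmonic n = Σ< n 1/[1+_]

harmonic-+ : ∀ a b → harmonic (a ℕ.+ b) ≡ harmonic a ℚ.+ Σ< b (λ j → 1/[1+ a ℕ.+ j ])
harmonic-+ a zero    = trans (cong harmonic (ℕ.+-identityʳ a)) (sym (ℚ.+-identityʳ _))
harmonic-+ a (suc b) = begin-equality
  harmonic (a ℕ.+ suc b)                      ≡⟨ cong harmonic (ℕ.+-suc a b) ⟩
  harmonic (a ℕ.+ b) ℚ.+ 1/[1+ a ℕ.+ b ]      ≡⟨ cong (ℚ._+ 1/[1+ a ℕ.+ b ]) (harmonic-+ a b) ⟩
  harmonic a ℚ.+ Σ< b _ ℚ.+ 1/[1+ a ℕ.+ b ]   ≡⟨ ℚ.+-assoc (harmonic a) _ _ ⟩
  harmonic a ℚ.+ Σ< (suc b) _                 ∎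

-- With N = k + 1, passing from mesh 1/N to 1/(N + 1) adds the (m+1) terms
-- of `logIncrement` and removes the term 1/(N + 1).
logIncrement : ℕ → ℕ → ℚ
logIncrement m k = Σ< (suc m) (λ j → 1/[1+ suc m ℕ.* suc k ℕ.+ j ])

logIncrement-upper : ∀ m k → logIncrement m k ℚ.≤ 1/[1+ k ]
logIncrement-upper m k = ℚ.≤-trans
  (Σ<-upper (suc m) (λ j _ → 1/[1+]-anti
    (ℕ.≤-trans (ℕ.n≤1+n (k ℕ.+ m ℕ.* suc k)) (ℕ.m≤m+n (suc m ℕ.* suc k) j))))
  (ℚ.≤-reflexive (*-1/[1+] m k))

logIncrement-lower : ∀ m k → 1/[1+ suc k ] ℚ.≤ logIncrement m k
logIncrement-lower m k = ℚ.≤-trans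
  (ℚ.≤-reflexive (sym (*-1/[1+] m (suc k))))
  (Σ<-lower (suc m) (λ j j≤m → 1/[1+]-anti (ℕ.≤-trans
    (ℕ.+-monoʳ-≤ (suc m ℕ.* suc k) (ℕ.s≤s⁻¹ j≤m))
    (ℕ.≤-reflexive (trans (ℕ.+-assoc (suc k) (m ℕ.* suc k) m)
      (cong (suc k ℕ.+_) (trans (ℕ.+-comm (m ℕ.* suc k) m) (sym (ℕ.*-suc m (suc k))))))))))

logSum-step : ∀ n k → 1/[1+ suc k ] ℚ.+ logSum n (suc k) ≡ logSum n k ℚ.+ logIncrement (ℕ.pred n) k
logSum-step n k = begin-equality
  r ℚ.+ D′
    ≡⟨ S.solve 3 (λ h r d → r S.:+ d S.:= (S.:- h) S.:+ ((h S.:+ r) S.:+ d)) refl h r D′ ⟩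
  ℚ.- h ℚ.+ (harmonic (suc N) ℚ.+ D′)
    ≡⟨ cong (ℚ.- h ℚ.+_) (harmonic-+ (suc N) (m ℕ.* suc N)) ⟨
  ℚ.- h ℚ.+ harmonic (suc m ℕ.* suc N)
    ≡⟨ cong (λ x → ℚ.- h ℚ.+ harmonic x) (trans (ℕ.*-suc (suc m) N) (ℕ.+-comm (suc m) (suc m ℕ.* N))) ⟩
  ℚ.- h ℚ.+ harmonic (suc m ℕ.* N ℕ.+ suc m)
    ≡⟨ cong (ℚ.- h ℚ.+_) (harmonic-+ (suc m ℕ.* N) (suc m)) ⟩
  ℚ.- h ℚ.+ (harmonic (suc m ℕ.* N) ℚ.+ I)
    ≡⟨ cong (λ x → ℚ.- h ℚ.+ (x ℚ.+ I)) (harmonic-+ N (m ℕ.* N)) ⟩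
  ℚ.- h ℚ.+ (h ℚ.+ D ℚ.+ I)
    ≡⟨ S.solve 3 (λ h d i → (S.:- h) S.:+ ((h S.:+ d) S.:+ i) S.:= d S.:+ i) refl h D I ⟩
  D ℚ.+ I ∎
  where
  m N : ℕ
  m = ℕ.pred n
  N = suc k
  h r D D′ I : ℚ
  h = harmonic N
  r = 1/[1+ N ]
  D = logSum n k
  D′ = logSum n (suc k)
  I = logIncrement m k

private
  cancel : ∀ p {q r} → p ℚ.+ q ℚ.≤ p ℚ.+ r → q ℚ.≤ r
  cancel p {q} {r} le = begin
    q                        ≡⟨ S.solve 2 (λ p q → q S.:= (S.:- p) S.:+ (p S.:+ q)) refl p q ⟩
    ℚ.- p ℚ.+ (p ℚ.+ q)      ≤⟨ ℚ.+-monoʳ-≤ (ℚ.- p) le ⟩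
    ℚ.- p ℚ.+ (p ℚ.+ r)      ≡⟨ S.solve 2 (λ p q → q S.:= (S.:- p) S.:+ (p S.:+ q)) refl p r ⟨
    r                        ∎

logSum-mono : ∀ n i k → logSum n k ℚ.≤ logSum n (i ℕ.+ k)
logSum-mono n zero    k = ℚ.≤-refl
logSum-mono n (suc i) k = ℚ.≤-trans (logSum-mono n i k) (cancel r (begin
  r ℚ.+ logSum n j                         ≡⟨ ℚ.+-comm r (logSum n j) ⟩
  logSum n j ℚ.+ r                         ≤⟨ ℚ.+-monoʳ-≤ (logSum n j) (logIncrement-lower (ℕ.pred n) j) ⟩
  logSum n j ℚ.+ logIncrement (ℕ.pred n) j ≡⟨ logSum-step n j ⟨
  r ℚ.+ logSum n (suc j)                   ∎))
  where
  j : ℕ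
  j = i ℕ.+ k
  r : ℚ
  r = 1/[1+ suc j ]

logSum-anti : ∀ n i k → 1/[1+ i ℕ.+ k ] ℚ.+ logSum n (i ℕ.+ k) ℚ.≤ logSum n k ℚ.+ 1/[1+ k ]
logSum-anti n zero    k = ℚ.≤-reflexive (ℚ.+-comm 1/[1+ k ] (logSum n k))
logSum-anti n (suc i) k = begin
  1/[1+ suc j ] ℚ.+ logSum n (suc j)        ≡⟨ logSum-step n j ⟩
  logSum n j ℚ.+ logIncrement (ℕ.pred n) j  ≤⟨ ℚ.+-monoʳ-≤ (logSum n j) (logIncrement-upper (ℕ.pred n) j) ⟩
  logSum n j ℚ.+ 1/[1+ j ]                  ≡⟨ ℚ.+-comm (logSum n j) 1/[1+ j ] ⟩
  1/[1+ j ] ℚ.+ logSum n j                  ≤⟨ logSum-anti n i k ⟩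
  logSum n k ℚ.+ 1/[1+ k ]                  ∎
  where
  j : ℕ
  j = i ℕ.+ k

logSum-lower : ∀ n {k l} → k ℕ.≤ l → logSum n k ℚ.≤ logSum n l
logSum-lower n {k} {l} k≤l = subst (λ x → logSum n k ℚ.≤ logSum n x)
  (ℕ.m∸n+n≡m k≤l) (logSum-mono n (l ℕ.∸ k) k)

logSum-upper : ∀ n {k l} → k ℕ.≤ l → logSum n l ℚ.≤ logSum n k ℚ.+ 1/[1+ k ]
logSum-upper n {k} {l} k≤l = begin
  logSum n l                  ≡⟨ ℚ.+-identityˡ (logSum n l) ⟨
  0ℚ ℚ.+ logSum n l           ≤⟨ ℚ.+-monoˡ-≤ (logSum n l) (ℚ.<⇒≤ 0<1/[1+ l ]) ⟩
  1/[1+ l ] ℚ.+ logSum n l    ≤⟨ subst (λ x → 1/[1+ x ] ℚ.+ logSum n x ℚ.≤ logSum n k ℚ.+ 1/[1+ k ])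
                                   (ℕ.m∸n+n≡m k≤l) (logSum-anti n (l ℕ.∸ k) k) ⟩
  logSum n k ℚ.+ 1/[1+ k ]    ∎

archimedean : ∀ ε → 0ℚ ℚ.< ε → ∃[ N ] 1/[1+ N ] ℚ.≤ ε
archimedean (ℚ.mkℚ ℤ.+[1+ n ] k c) _ = k , ℚ.toℚᵘ-cancel-≤ (ℚᵘ.≤-trans
  (ℚᵘ.≤-reflexive (ℚ.toℚᵘ-fromℚᵘ (ℚᵘ.mkℚᵘ (+ 1) k)))
  (ℚᵘ.*≤* (ℤ.*-monoʳ-≤-nonNeg (+ suc k) (ℤ.+≤+ {1} {suc n} (s≤s z≤n)))))
archimedean (ℚ.mkℚ (+ zero)     k c) (ℚ.*<* lt) = ⊥-elim (ℤ.<-irrefl (sym (ℤ.*-zeroˡ (+ 1))) lt)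
archimedean (ℚ.mkℚ ℤ.-[1+ n ]   k c) (ℚ.*<* ())

log : ℕ → ℝ
log n .seq = logSum n
log n .cauchy ε 0<ε =
  let (N , rN≤ε) = archimedean ε 0<ε
      close = λ k l N≤k N≤l → ℚ.≤-trans (logSum-upper n N≤k)
                (ℚ.+-mono-≤ (logSum-lower n N≤l) rN≤ε)
  in N , λ k l N≤k N≤l → near (close k l N≤k N≤l) (close l k N≤l N≤k)

instance
  log-positive : ∀ {n} → .{{NonTrivial n}} → Positive (log n)
  log-positive {suc (suc n)} = record
    { bound      = ½
    ; 0<bound    = ℚ.positive⁻¹ ½
    ; from       = 0
    ; eventually = λ k _ → ℚ.≤-trans (½≤ (n ℕ.* 1)) (logSum-lower (suc (suc n)) {0} {k} z≤n)
    }
    where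
    ½≤ : ∀ i → ½ ℚ.≤ Σ< (suc i) (λ j → 1/[1+ suc j ])
    ½≤ zero    = ℚ.≤-refl
    ½≤ (suc i) = ℚ.≤-trans (½≤ i) (ℚ.≤-trans (ℚ.≤-reflexive (sym (ℚ.+-identityʳ _)))
      (ℚ.+-monoʳ-≤ (Σ< (suc i) (λ j → 1/[1+ suc j ])) (ℚ.<⇒≤ 0<1/[1+ suc (suc i) ])))

  +-nonTrivial : ∀ {a b} → .{{NonZero a}} → .{{NonZero b}} → NonTrivial (a ℕ.+ b)
  +-nonTrivial {a} {b} = ℕ.n>1⇒nonTrivial (ℕ.+-mono-≤ (ℕ.>-nonZero⁻¹ a) (ℕ.>-nonZero⁻¹ b))

-- Let R = rad (a b c), K = ‖ψ‖ and W = W(a,b).  The element R · d n of Ω is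
-- divisible by n for n = a, b, c.  Additivity of ψ at (a,b) gives
-- W = a dᵠ c − c dᵠ a, so R W is divisible by both a b and c, and these are
-- coprime; as W ≠ 0, this yields a b c ≤ R |W|.  Conversely 1/p ≤ 1/2 gives
-- 2 |dᵠ n| ≤ K n e, where e is the number of prime factors of n counted with
-- multiplicity, so 2 |W| ≤ a b K e with 2 ^ e ≤ a b ≤ c².  Together
-- 2 c ≤ R K e, and e log 2 ≤ 2 log c.
module Submission where

open import Defs
open import Data.Integer.Base using (+_)
open import Data.Nat.Base using (ℕ; NonZero; _+_; _*_)
open import Data.Nat.Coprimality using (Coprime)
open import Data.Product.Base using (_,_)
open import Relation.Binary.PropositionalEquality using (_≢_)

open import Algebra.Properties.Group using (∙-cancelˡ)
open import Data.Empty using (⊥-elim)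
open import Data.Integer.Base as ℤ using (ℤ; 0ℤ)
import Data.Integer.Properties as ℤ
import Data.Integer.Tactic.RingSolver as ℤSolver
open import Data.List.Base using ([]; _∷_; length; upTo)
open import Data.List.Membership.Propositional.Properties using (∈-filter⁺; ∈-upTo⁺)
open import Data.List.Relation.Unary.All as All using (All; []; _∷_)
open import Data.List.Relation.Unary.All.Properties using (all-filter)
open import Data.Nat.Base
  using (zero; suc; z≤n; s≤s; _≤_; _<_; _≤′_; ≤′-refl; ≤′-step; _^_;
         >-nonZero; >-nonZero⁻¹; ≢-nonZero; ≢-nonZero⁻¹; nonTrivial⇒n>1)
open import Data.Nat.Coprimality as Coprime using (coprime-divisor; coprime-+)
open import Data.Nat.Divisibility
open import Data.Nat.DivMod using (m*n/n≡m)
open import Data.Nat.ListAction using (product)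
open import Data.Nat.ListAction.Properties using (∈⇒∣product; product≢0)
open import Data.Nat.Primality
open import Data.Nat.Primality.Factorisation using (PrimeFactorisation; factorise)
open import Data.Nat.Properties
open import Data.Nat.Tactic.RingSolver using (solve-∀)
open import Data.Product.Base using (∃-syntax; _×_; proj₁; proj₂)
open import Data.Rational.Base as ℚ using (ℚ; 0ℚ; 1ℚ; ½)
import Data.Rational.Properties as ℚ
open import Data.Rational.Solver using (module +-*-Solver)
open import Data.Sum.Base using (_⊎_; inj₁; inj₂; [_,_]′)
open import Relation.Binary.PropositionalEquality hiding (_≢_)
open import Relation.Nullary using (yes; no; contradiction)
open import Relation.Nullary.Decidable using (_×-dec_)

val≢0 : ∀ P → NonZero (val P)
val≢0 P = prime⇒nonZero (val-prime P)

1<val : ∀ P → 1 < val P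
1<val P = nonTrivial⇒n>1 (val P) {{prime⇒nonTrivial (val-prime P)}}

-- Valuations

largestPower-∣ : ∀ p n k → p ^ largestPower p n k ∣ n
largestPower-∣ p n zero = 1∣ n
largestPower-∣ p n (suc k) with (p ^ suc k) ∣? n
... | yes p^∣n = p^∣n
... | no  _    = largestPower-∣ p n k

largestPower-max : ∀ p n k {e} → e ≤ k → p ^ e ∣ n → e ≤ largestPower p n k
largestPower-max p n zero    e≤0 _ = e≤0
largestPower-max p n (suc k) {e} e≤1+k p^e∣n with (p ^ suc k) ∣? n
... | yes _    = e≤1+k
... | no  p^∤n = largestPower-max p n k
  (≤-pred (≤∧≢⇒< e≤1+k λ { refl → p^∤n p^e∣n })) p^e∣n

n<p^n : ∀ {p} → 1 < p → ∀ n → n < p ^ n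
n<p^n 1<p zero    = s≤s z≤n
n<p^n {p} 1<p (suc n) = ≤-<-trans (n<p^n 1<p n) (^-monoʳ-< p 1<p (n<1+n n))

v-∣ : ∀ P n → val P ^ v P (+ n) ∣ n
v-∣ P n = largestPower-∣ (val P) n n

-- Since e < p^e ≤ n, the exponent e lies in the range that the search in `v` covers.
v-max : ∀ P n .{{_ : NonZero n}} {e} → val P ^ e ∣ n → e ≤ v P (+ n)
v-max P n {e} p^e∣n = largestPower-max (val P) n n
  (<⇒≤ (<-≤-trans (n<p^n (1<val P) e) (∣⇒≤ p^e∣n))) p^e∣n

v≡0⊎∣ : ∀ P n → v P (+ n) ≡ 0 ⊎ val P ∣ n
v≡0⊎∣ P n with v P (+ n) | v-∣ P n
... | zero  | _    = inj₁ refl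
... | suc e | p^∣n = inj₂ (∣-trans (m∣m*n (val P ^ e)) p^∣n)

-- A positive power of p dividing p m loses one factor p by cancellation, and a power dividing m
-- gains one. Maximality of `v` turns both facts into inequalities.
v-self-* : ∀ P m .{{_ : NonZero m}} → v P (+ (val P * m)) ≡ suc (v P (+ m))
v-self-* P m = ≤-antisym upper
  (v-max P (val P * m) {{m*n≢0 (val P) m {{val≢0 P}}}} (*-monoʳ-∣ (val P) (v-∣ P m)))
  where
  upper : v P (+ (val P * m)) ≤ suc (v P (+ m))
  upper with v P (+ (val P * m)) | v-∣ P (val P * m)
  ... | zero  | _    = z≤n
  ... | suc e | p^∣pm = s≤s (v-max P m (*-cancelˡ-∣ (val P) {{val≢0 P}} p^∣pm))

prime∣^ : ∀ {p} → Prime p → ∀ q e → p ∣ q ^ e → p ∣ q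
prime∣^ pr q zero    p∣1 = ∣-trans p∣1 (1∣ q)
prime∣^ pr q (suc e) p∣q^ with euclidsLemma q (q ^ e) pr p∣q^
... | inj₁ p∣q = p∣q
... | inj₂ p∣q^e = prime∣^ pr q e p∣q^e

-- A common divisor divides the prime p, so it is 1 or p; in the second case p divides q^e, hence q,
-- which forces p = q.
distinct-coprime : ∀ {p q} → Prime p → Prime q → p ≢ q → ∀ e → Coprime (q ^ e) p
distinct-coprime {p} {q} pp pq p≢q e (i∣q^e , i∣p) with prime⇒irreducible pp i∣p
... | inj₁ i≡1 = i≡1
... | inj₂ refl with prime⇒irreducible pq (prime∣^ pp q e i∣q^e)
...   | inj₁ refl = contradiction pp ¬prime[1]
...   | inj₂ p≡q  = contradiction p≡q p≢q

-- A power of q dividing p m is coprime to p, so it already divides m.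
v-other-* : ∀ P Q m .{{_ : NonZero m}} → val P ≢ val Q → v Q (+ (val P * m)) ≡ v Q (+ m)
v-other-* P Q m p≢q = ≤-antisym
  (v-max Q m (coprime-divisor
    (distinct-coprime (val-prime P) (val-prime Q) p≢q (v Q (+ (val P * m))))
    (v-∣ Q (val P * m))))
  (v-max Q (val P * m) {{m*n≢0 (val P) m {{val≢0 P}}}} (∣n⇒∣m*n (val P) (v-∣ Q m)))

-- Either the valuation is 0 or p divides n and hence R. With R = n this is the exactness of n v/p;
-- with R a radical it is the exactness of R v/p.
∣-*v : ∀ P n {R} → (val P ∣ n → val P ∣ R) → val P ∣ R * v P (+ n)
∣-*v P n {R} p∣n⇒p∣R with v≡0⊎∣ P n
... | inj₁ v≡0 = subst (val P ∣_) (sym (trans (cong (R *_) v≡0) (*-zeroʳ R))) (val P ∣0)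
... | inj₂ p∣n = ∣m⇒∣m*n (v P (+ n)) (p∣n⇒p∣R p∣n)

-- The derivation d

-- Replaces the integer division in `dCoeff` by a certificate that it is exact, so that coefficients
-- can be computed by multiplication in ℕ.
dCoeff-unique : ∀ n P {k} → n * v P (+ n) ≡ k * val P → coeff (d (+ n)) P ≡ + k
dCoeff-unique n P@(mkℙ p pr) {k} eq = trans
  (cong (ℤ._/ℕ p) (trans (sym (ℤ.pos-* n (v P (+ n)))) (cong +_ eq)))
  (cong +_ (m*n/n≡m k p))
  where
  instance
    p≢0 : NonZero p
    p≢0 = val≢0 P

d-1 : d (+ 1) ≈Ω 0Ω
d-1 P = dCoeff-unique 1 P (v1 (v≡0⊎∣ P 1))
  where
  v1 : v P (+ 1) ≡ 0 ⊎ val P ∣ 1 → 1 * v P (+ 1) ≡ 0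
  v1 (inj₁ v≡0) = cong (1 *_) v≡0
  v1 (inj₂ p∣1) = contradiction (∣1⇒≡1 p∣1) (>⇒≢ (1<val P))

-- The Leibniz rule for a prime factor, with d p = ξ p inserted. At p the valuation rises by one,
-- which contributes the extra m; at other primes it does not change. Induction over a prime
-- factorisation needs only this case.
d-prime-* : ∀ P m .{{_ : NonZero m}} →
            d (+ (val P * m)) ≈Ω (+ val P) ·Ω d (+ m) +Ω (+ m) ·Ω ξ P
d-prime-* P m Q with ∣-*v Q m {m} (λ q∣m → q∣m)
... | divides j m*v≡j*q with val P ≟ val Q
-- This is the test inside `ξ`, so the coefficient of `ξ P` at `Q` computes to 1 here and to 0 in
-- the other branch.
...   | yes p≡q = begin
  coeff (d (+ (p * m))) Q                      ≡⟨ dCoeff-unique (p * m) Q eq ⟩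
  + (p * j + m)                                ≡⟨ cong (ℤ._+ + m) (ℤ.pos-* p j) ⟩
  + p ℤ.* + j ℤ.+ + m                          ≡⟨ cong₂ (λ x y → + p ℤ.* x ℤ.+ y) (dCoeff-unique m Q m*v≡j*q) (ℤ.*-identityʳ (+ m)) ⟨
  + p ℤ.* coeff (d (+ m)) Q ℤ.+ + m ℤ.* ℤ.1ℤ   ∎
  where
  open ≡-Reasoning
  p q : ℕ
  p = val P
  q = val Q
  eq : p * m * v Q (+ (p * m)) ≡ (p * j + m) * q
  eq = begin
    p * m * v Q (+ (p * m))     ≡⟨ cong (λ x → p * m * v Q (+ (x * m))) p≡q ⟩
    p * m * v Q (+ (q * m))     ≡⟨ cong (p * m *_) (v-self-* Q m) ⟩
    p * m * suc (v Q (+ m))     ≡⟨ lemma p m (v Q (+ m)) ⟩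
    p * (m * v Q (+ m)) + p * m ≡⟨ cong₂ (λ x y → p * x + y * m) m*v≡j*q p≡q ⟩
    p * (j * q) + q * m         ≡⟨ lemma′ p j q m ⟩
    (p * j + m) * q             ∎
    where
    lemma : ∀ p m v → p * m * suc v ≡ p * (m * v) + p * m
    lemma = solve-∀
    lemma′ : ∀ p j q m → p * (j * q) + q * m ≡ (p * j + m) * q
    lemma′ = solve-∀
...   | no p≢q = begin
  coeff (d (+ (p * m))) Q                      ≡⟨ dCoeff-unique (p * m) Q eq ⟩
  + (p * j)                                    ≡⟨ ℤ.pos-* p j ⟩
  + p ℤ.* + j                                  ≡⟨ ℤ.+-identityʳ _ ⟨
  + p ℤ.* + j ℤ.+ 0ℤ                           ≡⟨ cong₂ (λ x y → + p ℤ.* x ℤ.+ y) (dCoeff-unique m Q m*v≡j*q) (ℤ.*-zeroʳ (+ m)) ⟨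
  + p ℤ.* coeff (d (+ m)) Q ℤ.+ + m ℤ.* 0ℤ     ∎
  where
  open ≡-Reasoning
  p : ℕ
  p = val P
  eq : p * m * v Q (+ (p * m)) ≡ p * j * val Q
  eq = begin
    p * m * v Q (+ (p * m)) ≡⟨ cong (p * m *_) (v-other-* P Q m p≢q) ⟩
    p * m * v Q (+ m)       ≡⟨ *-assoc p m _ ⟩
    p * (m * v Q (+ m))     ≡⟨ cong (p *_) m*v≡j*q ⟩
    p * (j * val Q)         ≡⟨ *-assoc p j _ ⟨
    p * j * val Q           ∎

-- R · (n vₚ(n) / p) = n · (R vₚ(n) / p), where the last quotient is exact
-- because p ∣ R unless vₚ(n) = 0.
R·d-divisible : ∀ R n .{{_ : NonZero n}} → (∀ P → val P ∣ n → val P ∣ R) →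
  ∃[ y ] (+ R) ·Ω d (+ n) ≈Ω (+ n) ·Ω y
R·d-divisible R n supp⊆ = y , λ P → eq P
  where
  open ≡-Reasoning
  div : ∀ P → val P ∣ R * v P (+ n)
  div P = ∣-*v P n (supp⊆ P)
  y : Ω
  y = record
    { coeff  = λ P → + quotient (div P)
    -- A prime above n does not divide n, so its valuation and with it the quotient vanish.
    ; finite = n , λ P n<p → cong +_ (vanish P n<p (v≡0⊎∣ P n))
    }
    where
    vanish : ∀ P → n < val P → v P (+ n) ≡ 0 ⊎ val P ∣ n → quotient (div P) ≡ 0
    vanish P n<p (inj₂ p∣n) = contradiction (∣⇒≤ p∣n) (<⇒≱ n<p)
    vanish P n<p (inj₁ v≡0) = *-cancelʳ-≡ (quotient (div P)) 0 (val P) {{val≢0 P}}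
      (trans (sym (_∣_.equality (div P))) (trans (cong (R *_) v≡0) (*-zeroʳ R)))
  eq : ∀ P → + R ℤ.* coeff (d (+ n)) P ≡ + n ℤ.* + quotient (div P)
  eq P with ∣-*v P n {n} (λ p∣n → p∣n)
  ... | divides j n*v≡j*p = begin
    + R ℤ.* coeff (d (+ n)) P    ≡⟨ cong (+ R ℤ.*_) (dCoeff-unique n P n*v≡j*p) ⟩
    + R ℤ.* + j                  ≡⟨ ℤ.pos-* R j ⟨
    + (R * j)                    ≡⟨ cong +_ (*-cancelʳ-≡ (R * j) (n * i) (val P) {{val≢0 P}} Rjp≡nip) ⟩
    + (n * i)                    ≡⟨ ℤ.pos-* n i ⟩
    + n ℤ.* + i                  ∎
    where
    i : ℕ
    i = quotient (div P)
    swap : ∀ R n v → R * (n * v) ≡ n * (R * v)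
    swap = solve-∀
    -- Multiplied by p, both sides become R n v, so the two exact quotients `j` and `i` need not be
    -- compared directly.
    Rjp≡nip : R * j * val P ≡ n * i * val P
    Rjp≡nip = begin
      R * j * val P          ≡⟨ *-assoc R j _ ⟩
      R * (j * val P)        ≡⟨ cong (R *_) n*v≡j*p ⟨
      R * (n * v P (+ n))    ≡⟨ swap R n _ ⟩
      n * (R * v P (+ n))    ≡⟨ cong (n *_) (_∣_.equality (div P)) ⟩
      n * (i * val P)        ≡⟨ *-assoc n i _ ⟨
      n * i * val P          ∎

-- The radical

∣-rad : ∀ n .{{_ : NonZero n}} P → val P ∣ n → val P ∣ rad n
∣-rad n P p∣n = ∈⇒∣product (∈-filter⁺ (λ p → prime? p ×-dec (p ∣? n))
  (∈-upTo⁺ (s≤s (∣⇒≤ p∣n))) (val-prime P , p∣n))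

rad-nonZero : ∀ n → NonZero (rad n)
rad-nonZero n = product≢0 (All.map (λ (pr , _) → prime⇒nonZero pr)
  (all-filter (λ p → prime? p ×-dec (p ∣? n)) (upTo (suc n))))

-- Divisibility and size of the derivative attached to ψ

module _ (ψ : 𝒯) where
  open IsModuleHomomorphism (linear ψ) using (⟦⟧-cong; +ᴹ-homo; *ₗ-homo; 0ᴹ-homo)

  d^-1 : d^ ψ (+ 1) ≡ 0ℤ
  d^-1 = trans (⟦⟧-cong d-1) 0ᴹ-homo

  d^-prime-* : ∀ P m .{{_ : NonZero m}} →
    d^ ψ (+ (val P * m)) ≡ + val P ℤ.* d^ ψ (+ m) ℤ.+ + m ℤ.* ⟦ ψ ⟧ (ξ P)
  d^-prime-* P m = trans (⟦⟧-cong (d-prime-* P m)) (trans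
    (+ᴹ-homo ((+ val P) ·Ω d (+ m)) ((+ m) ·Ω ξ P))
    (cong₂ ℤ._+_ (*ₗ-homo (+ val P) (d (+ m))) (*ₗ-homo (+ m) (ξ P))))

  -- ψ is linear on Ω, so a cofactor that is itself an element of Ω is mapped to an integer
  -- cofactor.
  R*d^-divisible : ∀ R n .{{_ : NonZero n}} → (∀ P → val P ∣ n → val P ∣ R) →
    ∃[ y ] + R ℤ.* d^ ψ (+ n) ≡ + n ℤ.* y
  R*d^-divisible R n supp⊆ with R·d-divisible R n supp⊆
  ... | y , eq = ⟦ ψ ⟧ y , trans (sym (*ₗ-homo (+ R) (d (+ n))))
                             (trans (⟦⟧-cong eq) (*ₗ-homo (+ n) y))

  module _ {K} (ψ≤K : ∀ P → ℤ.∣ ⟦ ψ ⟧ (ξ P) ∣ ≤ K) where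

    -- Induction by the Leibniz rule: a new prime p multiplies the old bound by p and adds a term of
    -- size at most m K. Nonvanishing of the product is carried along because the Leibniz rule asks
    -- for it.
    d^-product-bound : ∀ {ps} → All Prime ps → NonZero (product ps) ×
      2 ^ length ps ≤ product ps × 2 * ℤ.∣ d^ ψ (+ product ps) ∣ ≤ K * product ps * length ps
    d^-product-bound [] = _ , ≤-refl , ≤-trans
      (≤-reflexive (cong (λ z → 2 * ℤ.∣ z ∣) d^-1)) z≤n
    d^-product-bound {p ∷ ps} (pr ∷ prs) with d^-product-bound prs
    ... | m≢0 , 2^e≤m , bnd = m*n≢0 p m {{prime⇒nonZero pr}} {{m≢0}} ,
          *-mono-≤ (1<val P) 2^e≤m , (begin
      2 * ℤ.∣ d^ ψ (+ (p * m)) ∣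
        ≡⟨ cong (λ z → 2 * ℤ.∣ z ∣) (d^-prime-* P m {{m≢0}}) ⟩
      2 * ℤ.∣ + p ℤ.* d^ ψ (+ m) ℤ.+ + m ℤ.* ⟦ ψ ⟧ (ξ P) ∣
        ≤⟨ *-monoʳ-≤ 2 (ℤ.∣i+j∣≤∣i∣+∣j∣ (+ p ℤ.* d^ ψ (+ m)) (+ m ℤ.* ⟦ ψ ⟧ (ξ P))) ⟩
      2 * (ℤ.∣ + p ℤ.* d^ ψ (+ m) ∣ + ℤ.∣ + m ℤ.* ⟦ ψ ⟧ (ξ P) ∣)
        ≡⟨ cong₂ (λ x y → 2 * (x + y)) (ℤ.abs-* (+ p) (d^ ψ (+ m))) (ℤ.abs-* (+ m) (⟦ ψ ⟧ (ξ P))) ⟩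
      2 * (p * D + m * ℤ.∣ ⟦ ψ ⟧ (ξ P) ∣)
        ≡⟨ rearrange p D (m * ℤ.∣ ⟦ ψ ⟧ (ξ P) ∣) ⟩
      p * (2 * D) + 2 * (m * ℤ.∣ ⟦ ψ ⟧ (ξ P) ∣)
        -- Here 2 ≤ p absorbs the factor 2 of the new term, which then counts as one more prime
        -- factor.
        ≤⟨ +-mono-≤ (*-monoʳ-≤ p bnd) (*-mono-≤ (1<val P) (*-monoʳ-≤ m (ψ≤K P))) ⟩
      p * (K * m * length ps) + p * (m * K)
        ≡⟨ collect p K m (length ps) ⟩
      K * (p * m) * suc (length ps) ∎)
      where
      open ≤-Reasoning
      P : ℙ
      P = mkℙ p pr
      m D : ℕ
      m = product ps
      D = ℤ.∣ d^ ψ (+ m) ∣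
      rearrange : ∀ p D x → 2 * (p * D + x) ≡ p * (2 * D) + 2 * x
      rearrange = solve-∀
      collect : ∀ p K m e → p * (K * m * e) + p * (m * K) ≡ K * (p * m) * suc e
      collect = solve-∀

    d^-bound : ∀ n .{{_ : NonZero n}} →
      ∃[ e ] 2 ^ e ≤ n × 2 * ℤ.∣ d^ ψ (+ n) ∣ ≤ K * n * e
    d^-bound n = length (factors f) ,
      subst (λ n → 2 ^ length (factors f) ≤ n × 2 * ℤ.∣ d^ ψ (+ n) ∣ ≤ K * n * length (factors f))
        (sym (isFactorisation f)) (proj₂ (d^-product-bound (factorsPrime f)))
      where
      open PrimeFactorisation
      f : PrimeFactorisation n
      f = factorise n

-- Lower and upper bounds for W

-- The sum is coprime to a and to b, so both can be removed and a + b divides the nonzero x.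
sum≤cofactor : ∀ {a b x} → Coprime a b → a + b ∣ a * b * x → x ≢ 0 → a + b ≤ x
sum≤cofactor {a} {b} {x} a⊥b c∣abx x≢0 = ∣⇒≤ {{≢-nonZero x≢0}}
  (coprime-divisor c⊥b (coprime-divisor c⊥a (subst (a + b ∣_) (*-assoc a b x) c∣abx)))
  where
  c⊥a : Coprime (a + b) a
  c⊥a = coprime-+ (Coprime.sym a⊥b)
  c⊥b : Coprime (a + b) b
  c⊥b = subst (λ c → Coprime c b) (+-comm b a) (coprime-+ a⊥b)

module _ (a b : ℕ) .{{_ : NonZero a}} .{{_ : NonZero b}} (a⊥b : Coprime a b)
         {ψ : 𝒯} (ψ∈ : ψ ∈𝒯[ a , b ]) (W≢0 : Independent ψ (+ a) (+ b)) where

  private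
    c R K : ℕ
    c = a + b
    R = rad (a * b * c)
    K = ‖ ψ∈ ‖
    w : ℤ
    w = W ψ (+ a) (+ b)

    instance
      ab≢0 : NonZero (a * b)
      ab≢0 = m*n≢0 a b
      c≢0 : NonZero c
      c≢0 = >-nonZero (≤-trans (>-nonZero⁻¹ a) (m≤m+n a b))
      abc≢0 : NonZero (a * b * c)
      abc≢0 = m*n≢0 (a * b) c
      R≢0 : NonZero R
      R≢0 = rad-nonZero (a * b * c)

    a∣abc : a ∣ a * b * c
    a∣abc = ∣m⇒∣m*n c (m∣m*n b)
    b∣abc : b ∣ a * b * c
    b∣abc = ∣m⇒∣m*n c (n∣m*n a)
    c∣abc : c ∣ a * b * c
    c∣abc = n∣m*n (a * b)

    -- For n among a, b, c every prime divisor of n divides a b c and hence R.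
    y : ∀ n .{{_ : NonZero n}} → n ∣ a * b * c → ∃[ y ] + R ℤ.* d^ ψ (+ n) ≡ + n ℤ.* y
    y n n∣abc = R*d^-divisible ψ R n (λ P p∣n → ∣-rad (a * b * c) P (∣-trans p∣n n∣abc))

    ya yb yc : ℤ
    ya = proj₁ (y a a∣abc)
    yb = proj₁ (y b b∣abc)
    yc = proj₁ (y c c∣abc)

    da db : ℤ
    da = d^ ψ (+ a)
    db = d^ ψ (+ b)

    -- Both R dᵠ b and R dᵠ a carry their argument as a factor, and the definition of W supplies the
    -- other one.
    RW≡ab : + R ℤ.* w ≡ (+ a ℤ.* + b) ℤ.* (yb ℤ.- ya)
    RW≡ab = begin
      + R ℤ.* (+ a ℤ.* db ℤ.- + b ℤ.* da)
        ≡⟨ lemma (+ R) (+ a) (+ b) da db ⟩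
      + a ℤ.* (+ R ℤ.* db) ℤ.- + b ℤ.* (+ R ℤ.* da)
        ≡⟨ cong₂ (λ p q → + a ℤ.* p ℤ.- + b ℤ.* q) (proj₂ (y b b∣abc)) (proj₂ (y a a∣abc)) ⟩
      + a ℤ.* (+ b ℤ.* yb) ℤ.- + b ℤ.* (+ a ℤ.* ya)
        ≡⟨ lemma′ (+ a) (+ b) ya yb ⟩
      (+ a ℤ.* + b) ℤ.* (yb ℤ.- ya) ∎
      where
      open ≡-Reasoning
      lemma : ∀ R a b da db → R ℤ.* (a ℤ.* db ℤ.- b ℤ.* da) ≡ a ℤ.* (R ℤ.* db) ℤ.- b ℤ.* (R ℤ.* da)
      lemma = ℤSolver.solve-∀
      lemma′ : ∀ a b ya yb → a ℤ.* (b ℤ.* yb) ℤ.- b ℤ.* (a ℤ.* ya) ≡ (a ℤ.* b) ℤ.* (yb ℤ.- ya)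
      lemma′ = ℤSolver.solve-∀

    -- W(a,b) = W(a,c) by additivity of ψ at (a,b).
    RW≡c : + R ℤ.* w ≡ + c ℤ.* (+ a ℤ.* (yc ℤ.- ya))
    RW≡c = begin
      + R ℤ.* (+ a ℤ.* db ℤ.- + b ℤ.* da)
        ≡⟨ lemma (+ R) (+ a) (+ b) da db ⟩
      + a ℤ.* (+ R ℤ.* (da ℤ.+ db)) ℤ.- + c ℤ.* (+ R ℤ.* da)
        ≡⟨ cong (λ z → + a ℤ.* (+ R ℤ.* z) ℤ.- + c ℤ.* (+ R ℤ.* da)) (additive ψ∈) ⟨
      + a ℤ.* (+ R ℤ.* d^ ψ (+ c)) ℤ.- + c ℤ.* (+ R ℤ.* da)
        ≡⟨ cong₂ (λ p q → + a ℤ.* p ℤ.- + c ℤ.* q) (proj₂ (y c c∣abc)) (proj₂ (y a a∣abc)) ⟩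
      + a ℤ.* (+ c ℤ.* yc) ℤ.- + c ℤ.* (+ a ℤ.* ya)
        ≡⟨ lemma′ (+ a) (+ c) ya yc ⟩
      + c ℤ.* (+ a ℤ.* (yc ℤ.- ya)) ∎
      where
      open ≡-Reasoning
      lemma : ∀ R a b da db → R ℤ.* (a ℤ.* db ℤ.- b ℤ.* da) ≡
        a ℤ.* (R ℤ.* (da ℤ.+ db)) ℤ.- (a ℤ.+ b) ℤ.* (R ℤ.* da)
      lemma = ℤSolver.solve-∀
      lemma′ : ∀ a c ya yc → a ℤ.* (c ℤ.* yc) ℤ.- c ℤ.* (a ℤ.* ya) ≡ c ℤ.* (a ℤ.* (yc ℤ.- ya))
      lemma′ = ℤSolver.solve-∀

    -- The cofactor of a b in R |W|; divisibility by c passes to it because c is coprime to a b.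
    x : ℕ
    x = ℤ.∣ yb ℤ.- ya ∣

    R∣W∣≡abx : R * ℤ.∣ w ∣ ≡ a * b * x
    R∣W∣≡abx = begin
      R * ℤ.∣ w ∣                               ≡⟨ ℤ.abs-* (+ R) w ⟨
      ℤ.∣ + R ℤ.* w ∣                           ≡⟨ cong ℤ.∣_∣ RW≡ab ⟩
      ℤ.∣ (+ a ℤ.* + b) ℤ.* (yb ℤ.- ya) ∣       ≡⟨ ℤ.abs-* (+ a ℤ.* + b) (yb ℤ.- ya) ⟩
      ℤ.∣ + a ℤ.* + b ∣ * x                     ≡⟨ cong (_* x) (ℤ.abs-* (+ a) (+ b)) ⟩
      a * b * x                                 ∎
      where open ≡-Reasoning

    c∣abx : c ∣ a * b * x
    c∣abx = subst (c ∣_) (begin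
      c * ℤ.∣ + a ℤ.* (yc ℤ.- ya) ∣     ≡⟨ ℤ.abs-* (+ c) _ ⟨
      ℤ.∣ + c ℤ.* (+ a ℤ.* (yc ℤ.- ya)) ∣ ≡⟨ cong ℤ.∣_∣ RW≡c ⟨
      ℤ.∣ + R ℤ.* w ∣                   ≡⟨ ℤ.abs-* (+ R) w ⟩
      R * ℤ.∣ w ∣                       ≡⟨ R∣W∣≡abx ⟩
      a * b * x                         ∎) (m∣m*n _)
      where open ≡-Reasoning

    -- Independence enters here: R |W| is a product of nonzero numbers.
    x≢0 : x ≢ 0
    x≢0 x≡0 = [ ≢-nonZero⁻¹ R , (λ w≡0 → W≢0 (ℤ.∣i∣≡0⇒i≡0 w≡0)) ]′
      (m*n≡0⇒m≡0∨n≡0 R (trans R∣W∣≡abx (trans (cong (a * b *_) x≡0) (*-zeroʳ (a * b)))))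

  Ω-exponent-bound : ∃[ e ] 2 ^ e ≤ c * c × 2 * c ≤ R * K * e
  -- The witness counts the prime factors of a b with multiplicity. The inequality is proved times a
  -- b, a factor common to the lower and upper bounds of R |W|, and then cancelled.
  Ω-exponent-bound = e + f , 2^≤c² , *-cancelˡ-≤ (a * b) (begin
    a * b * (2 * c)                             ≤⟨ *-monoʳ-≤ (a * b) (*-monoʳ-≤ 2 (sum≤cofactor a⊥b c∣abx x≢0)) ⟩
    a * b * (2 * x)                             ≡⟨ swap (a * b) 2 x ⟩
    2 * (a * b * x)                             ≡⟨ cong (2 *_) R∣W∣≡abx ⟨
    2 * (R * ℤ.∣ w ∣)                           ≡⟨ swap 2 R ℤ.∣ w ∣ ⟩
    R * (2 * ℤ.∣ w ∣)                           ≤⟨ *-monoʳ-≤ R (*-monoʳ-≤ 2 (ℤ.∣i-j∣≤∣i∣+∣j∣ (+ a ℤ.* db) (+ b ℤ.* da))) ⟩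
    R * (2 * (ℤ.∣ + a ℤ.* db ∣ + ℤ.∣ + b ℤ.* da ∣))
      ≡⟨ cong₂ (λ p q → R * (2 * (p + q))) (ℤ.abs-* (+ a) db) (ℤ.abs-* (+ b) da) ⟩
    R * (2 * (a * ℤ.∣ db ∣ + b * ℤ.∣ da ∣))     ≡⟨ cong (R *_) (distrib a b ℤ.∣ da ∣ ℤ.∣ db ∣) ⟩
    R * (a * (2 * ℤ.∣ db ∣) + b * (2 * ℤ.∣ da ∣))
      ≤⟨ *-monoʳ-≤ R (+-mono-≤ (*-monoʳ-≤ a (proj₂ (proj₂ boundᵦ))) (*-monoʳ-≤ b (proj₂ (proj₂ boundₐ)))) ⟩
    R * (a * (K * b * f) + b * (K * a * e))     ≡⟨ collect R K a b e f ⟩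
    a * b * (R * K * (e + f))                   ∎)
    where
    open ≤-Reasoning
    ψ≤K : ∀ P → ℤ.∣ ⟦ ψ ⟧ (ξ P) ∣ ≤ K
    ψ≤K = proj₁ (proj₂ (supNorm ψ∈))
    boundₐ : ∃[ e ] 2 ^ e ≤ a × 2 * ℤ.∣ da ∣ ≤ K * a * e
    boundₐ = d^-bound ψ ψ≤K a
    boundᵦ : ∃[ f ] 2 ^ f ≤ b × 2 * ℤ.∣ db ∣ ≤ K * b * f
    boundᵦ = d^-bound ψ ψ≤K b
    e f : ℕ
    e = proj₁ boundₐ
    f = proj₁ boundᵦ
    swap : ∀ p q r → p * (q * r) ≡ q * (p * r)
    swap = solve-∀
    distrib : ∀ a b p q → 2 * (a * q + b * p) ≡ a * (2 * q) + b * (2 * p)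
    distrib = solve-∀
    collect : ∀ R K a b e f → R * (a * (K * b * f) + b * (K * a * e)) ≡ a * b * (R * K * (e + f))
    collect = solve-∀
    2^≤c² : 2 ^ (e + f) ≤ c * c
    2^≤c² = begin
      2 ^ (e + f)       ≡⟨ ^-distribˡ-+-* 2 e f ⟩
      2 ^ e * 2 ^ f     ≤⟨ *-mono-≤ (≤-trans (proj₁ (proj₂ boundₐ)) (m≤m+n a b)) (≤-trans (proj₁ (proj₂ boundᵦ)) (m≤n+m b a)) ⟩
      c * c             ∎

-- Logarithms

ι : ℕ → ℚ
ι n = + n ℚ./ 1

ι-+ : ∀ m n → ι (m + n) ≡ ι m ℚ.+ ι n
ι-+ zero    n = sym (ℚ.+-identityˡ (ι n))
ι-+ (suc m) n = begin
  ι (suc (m + n))          ≡⟨ /1-suc (m + n) ⟩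
  ι (m + n) ℚ.+ 1ℚ         ≡⟨ cong (ℚ._+ 1ℚ) (ι-+ m n) ⟩
  ι m ℚ.+ ι n ℚ.+ 1ℚ       ≡⟨ solve 3 (λ m n o → m :+ n :+ o := m :+ o :+ n) refl (ι m) (ι n) 1ℚ ⟩
  ι m ℚ.+ 1ℚ ℚ.+ ι n       ≡⟨ cong (ℚ._+ ι n) (/1-suc m) ⟨
  ι (suc m) ℚ.+ ι n        ∎
  where
  open ≡-Reasoning
  open +-*-Solver

ι-* : ∀ m n → ι (m * n) ≡ ι m ℚ.* ι n
ι-* zero    n = sym (ℚ.*-zeroˡ (ι n))
ι-* (suc m) n = begin
  ι (n + m * n)                    ≡⟨ ι-+ n (m * n) ⟩
  ι n ℚ.+ ι (m * n)                ≡⟨ cong₂ ℚ._+_ (sym (ℚ.*-identityˡ (ι n))) (ι-* m n) ⟩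
  1ℚ ℚ.* ι n ℚ.+ ι m ℚ.* ι n       ≡⟨ solve 3 (λ m n o → o :* n :+ m :* n := (m :+ o) :* n) refl (ι m) (ι n) 1ℚ ⟩
  (ι m ℚ.+ 1ℚ) ℚ.* ι n             ≡⟨ cong (ℚ._* ι n) (/1-suc m) ⟨
  ι (suc m) ℚ.* ι n                ∎
  where
  open ≡-Reasoning
  open +-*-Solver

p≤p+q : ∀ p {q} → 0ℚ ℚ.≤ q → p ℚ.≤ p ℚ.+ q
p≤p+q p 0≤q = ℚ.≤-trans (ℚ.≤-reflexive (sym (ℚ.+-identityʳ p))) (ℚ.+-monoʳ-≤ p 0≤q)

0≤ι : ∀ n → 0ℚ ℚ.≤ ι n
0≤ι n = ℚ.nonNegative⁻¹ (ι n) {{ℚ.normalize-nonNeg n 1}}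

ι-mono : ∀ {m n} → m ≤ n → ι m ℚ.≤ ι n
ι-mono {m} {n} m≤n with m≤n⇒∃[o]m+o≡n m≤n
... | o , refl = ℚ.≤-trans (p≤p+q (ι m) (0≤ι o)) (ℚ.≤-reflexive (sym (ι-+ m o)))

Σ<-monoˡ : ∀ {f} → (∀ j → 0ℚ ℚ.≤ f j) → ∀ {m n} → m ≤ n → Σ< m f ℚ.≤ Σ< n f
Σ<-monoˡ {f} 0≤f {m} m≤n = go (≤⇒≤′ m≤n)
  where
  go : ∀ {n} → m ≤′ n → Σ< m f ℚ.≤ Σ< n f
  go ≤′-refl            = ℚ.≤-refl
  go (≤′-step {n} m≤′n) = ℚ.≤-trans (go m≤′n) (p≤p+q (Σ< n f) (0≤f n))

logSum-monoˡ : ∀ {m n} k → m ≤ n → logSum m k ℚ.≤ logSum n k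
logSum-monoˡ k m≤n = Σ<-monoˡ (λ j → ℚ.<⇒≤ 0<1/[1+ suc k + j ])
  (*-monoˡ-≤ (suc k) (pred-mono-≤ m≤n))

-- With N = k + 1, the sum is the difference H(nN) - H(N) of harmonic numbers; in this form products
-- under the logarithm telescope.
harmonic-logSum : ∀ n .{{_ : NonZero n}} k → harmonic (n * suc k) ≡ harmonic (suc k) ℚ.+ logSum n k
harmonic-logSum (suc n) k = harmonic-+ (suc k) (n * suc k)

-- ∫₁^{mn} splits at n, and x = n t turns the second part into a Riemann sum
-- for log m whose mesh is finer by the factor n.
logSum-* : ∀ m n .{{_ : NonZero n}} .{{_ : NonZero m}} k →
           ∃[ l ] k ≤ l × logSum (m * n) k ≡ logSum n k ℚ.+ logSum m l
logSum-* m n@(suc n-1) k = l , m≤m+n k _ , ∙-cancelˡ ℚ.+-0-group H _ _ (begin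
  H ℚ.+ logSum (m * n) k                  ≡⟨ harmonic-logSum (m * n) {{m*n≢0 m n}} k ⟨
  harmonic (m * n * suc k)                ≡⟨ cong harmonic (*-assoc m n (suc k)) ⟩
  harmonic (m * suc l)                    ≡⟨ harmonic-logSum m l ⟩
  harmonic (n * suc k) ℚ.+ logSum m l     ≡⟨ cong (ℚ._+ logSum m l) (harmonic-logSum n k) ⟩
  H ℚ.+ logSum n k ℚ.+ logSum m l         ≡⟨ ℚ.+-assoc H _ _ ⟩
  H ℚ.+ (logSum n k ℚ.+ logSum m l)       ∎)
  where
  open ≡-Reasoning
  l : ℕ
  -- Chosen so that `suc l` computes to `n * suc k`, the reciprocal of the finer mesh.
  l = k + n-1 * suc k
  H : ℚ
  H = harmonic (suc k)

-- Refinement increases these Riemann sums, so coarsening the second summand of `logSum-*` back to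
-- mesh index k only lowers it, and no error term appears.
logSum-^ : ∀ m .{{_ : NonZero m}} e k → ι e ℚ.* logSum m k ℚ.≤ logSum (m ^ e) k
logSum-^ m zero    k = ℚ.≤-reflexive (ℚ.*-zeroˡ (logSum m k))
logSum-^ m (suc e) k with logSum-* m (m ^ e) {{m^n≢0 m e}} k
... | l , k≤l , eq = begin
  ι (suc e) ℚ.* logSum m k                     ≡⟨ cong (ℚ._* logSum m k) (/1-suc e) ⟩
  (ι e ℚ.+ 1ℚ) ℚ.* logSum m k                  ≡⟨ ℚ.*-distribʳ-+ (logSum m k) (ι e) 1ℚ ⟩
  ι e ℚ.* logSum m k ℚ.+ 1ℚ ℚ.* logSum m k     ≡⟨ cong (ι e ℚ.* logSum m k ℚ.+_) (ℚ.*-identityˡ (logSum m k)) ⟩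
  ι e ℚ.* logSum m k ℚ.+ logSum m k            ≤⟨ ℚ.+-mono-≤ (logSum-^ m e k) (logSum-lower m k≤l) ⟩
  logSum (m ^ e) k ℚ.+ logSum m l              ≡⟨ eq ⟨
  logSum (m * m ^ e) k                         ∎
  where open ℚ.≤-Reasoning

-- In this direction the finer sum must be bounded above by the coarser one, which costs 1/(k+1).
logSum-square : ∀ n .{{_ : NonZero n}} k →
                logSum (n * n) k ℚ.≤ logSum n k ℚ.+ logSum n k ℚ.+ 1/[1+ k ]
logSum-square n k with logSum-* n n k
... | l , k≤l , eq = begin
  logSum (n * n) k                              ≡⟨ eq ⟩
  logSum n k ℚ.+ logSum n l                     ≤⟨ ℚ.+-monoʳ-≤ (logSum n k) (logSum-upper n k≤l) ⟩
  logSum n k ℚ.+ (logSum n k ℚ.+ 1/[1+ k ])     ≡⟨ ℚ.+-assoc (logSum n k) _ _ ⟨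
  logSum n k ℚ.+ logSum n k ℚ.+ 1/[1+ k ]       ∎
  where open ℚ.≤-Reasoning

-- The inequality e log 2 ≤ 2 log c at a fixed mesh, with an error that tends to 0.
2^≤square⇒logSum : ∀ e c .{{_ : NonZero c}} → 2 ^ e ≤ c * c → ∀ k →
  ι e ℚ.* logSum 2 k ℚ.≤ logSum c k ℚ.+ logSum c k ℚ.+ 1/[1+ k ]
2^≤square⇒logSum e c 2^e≤c² k = ℚ.≤-trans (logSum-^ 2 e k)
  (ℚ.≤-trans (logSum-monoˡ k 2^e≤c²) (logSum-square c k))

-- ½ is the coarsest Riemann sum for log 2; refining the mesh or enlarging c only increases it.
-- Uniformity in k keeps the reciprocals bounded.
½≤logSum : ∀ c → 2 ≤ c → ∀ k → ½ ℚ.≤ logSum c k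
½≤logSum c 2≤c k = ℚ.≤-trans (eventually (log-positive {2}) k z≤n) (logSum-monoˡ k 2≤c)

-- Rational estimates for quotients

*-mono : ∀ {p q r s} → 0ℚ ℚ.≤ r → 0ℚ ℚ.≤ q → p ℚ.≤ q → r ℚ.≤ s → p ℚ.* r ℚ.≤ q ℚ.* s
*-mono {p} {q} {r} {s} 0≤r 0≤q p≤q r≤s = ℚ.≤-trans
  (ℚ.*-monoʳ-≤-nonNeg r {{ℚ.nonNegative 0≤r}} p≤q)
  (ℚ.*-monoˡ-≤-nonNeg q {{ℚ.nonNegative 0≤q}} r≤s)

0≤* : ∀ {p q} → 0ℚ ℚ.≤ p → 0ℚ ℚ.≤ q → 0ℚ ℚ.≤ p ℚ.* q
0≤* {p} {q} 0≤p 0≤q = ℚ.nonNegative⁻¹ (p ℚ.* q)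
  {{ℚ.nonNeg*nonNeg⇒nonNeg p {{ℚ.nonNegative 0≤p}} q {{ℚ.nonNegative 0≤q}}}}

p+p≤q+q⇒p≤q : ∀ {p q} → p ℚ.+ p ℚ.≤ q ℚ.+ q → p ℚ.≤ q
p+p≤q+q⇒p≤q {p} {q} 2p≤2q with p ℚ.≤? q
... | yes p≤q = p≤q
... | no  p≰q = ⊥-elim (ℚ.<-irrefl refl
  (ℚ.<-≤-trans (ℚ.+-mono-< (ℚ.≰⇒> p≰q) (ℚ.≰⇒> p≰q)) 2p≤2q))

½≤⇒0< : ∀ {u} → ½ ℚ.≤ u → 0ℚ ℚ.< u
½≤⇒0< = ℚ.<-≤-trans (ℚ.positive⁻¹ ½)

recip≤2 : ∀ {u} → ½ ℚ.≤ u → recip u ℚ.≤ 1ℚ ℚ.+ 1ℚ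
recip≤2 {u} ½≤u = begin
  recip u                        ≡⟨ solve 1 (λ r → r := r :* con ½ :+ r :* con ½) refl (recip u) ⟩
  recip u ℚ.* ½ ℚ.+ recip u ℚ.* ½  ≤⟨ ℚ.+-mono-≤ r½≤1 r½≤1 ⟩
  1ℚ ℚ.+ 1ℚ                      ∎
  where
  open ℚ.≤-Reasoning
  open +-*-Solver
  0<u : 0ℚ ℚ.< u
  0<u = ½≤⇒0< ½≤u
  r½≤1 : recip u ℚ.* ½ ℚ.≤ 1ℚ
  r½≤1 = begin
    recip u ℚ.* ½    ≤⟨ ℚ.*-monoˡ-≤-nonNeg (recip u) {{ℚ.nonNegative (ℚ.<⇒≤ (recip-positive 0<u))}} ½≤u ⟩
    recip u ℚ.* u    ≡⟨ ℚ.*-comm (recip u) u ⟩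
    u ℚ.* recip u    ≡⟨ recip-inverse 0<u ⟩
    1ℚ               ∎

-- Eliminates E, the number of prime factors; u and w approximate log c and log 2, and h is the mesh
-- error. The hypotheses give 2 C w ≤ M (2 u + h). Division by 2 u w leaves the error M h / (2 u w),
-- and 1/(u w) ≤ 4 bounds it by 2 M h.
quotient-bound : ∀ {C M E u w h} → 0ℚ ℚ.≤ M → 0ℚ ℚ.≤ h → ½ ℚ.≤ u → ½ ℚ.≤ w →
  C ℚ.+ C ℚ.≤ M ℚ.* E → E ℚ.* w ℚ.≤ u ℚ.+ u ℚ.+ h →
  C ℚ.* recip u ℚ.≤ M ℚ.* recip w ℚ.+ (M ℚ.+ M) ℚ.* h
quotient-bound {C} {M} {E} {u} {w} {h} 0≤M 0≤h ½≤u ½≤w 2C≤ME Ew≤ = p+p≤q+q⇒p≤q (begin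
  C ℚ.* r ℚ.+ C ℚ.* r
    ≡⟨ ℚ.*-identityʳ _ ⟨
  (C ℚ.* r ℚ.+ C ℚ.* r) ℚ.* 1ℚ
    -- The factor w · (1/w) is inserted so that E will meet w and the second hypothesis applies.
    ≡⟨ cong ((C ℚ.* r ℚ.+ C ℚ.* r) ℚ.*_) (recip-inverse 0<w) ⟨
  (C ℚ.* r ℚ.+ C ℚ.* r) ℚ.* (w ℚ.* s)
    ≡⟨ solve 4 (λ C r w s → (C :* r :+ C :* r) :* (w :* s) := (C :+ C) :* (w :* (r :* s))) refl C r w s ⟩
  (C ℚ.+ C) ℚ.* (w ℚ.* (r ℚ.* s))
    ≤⟨ ℚ.*-monoʳ-≤-nonNeg (w ℚ.* (r ℚ.* s)) {{ℚ.nonNegative (0≤* (ℚ.<⇒≤ 0<w) 0≤rs)}} 2C≤ME ⟩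
  M ℚ.* E ℚ.* (w ℚ.* (r ℚ.* s))
    ≡⟨ solve 4 (λ M E w x → M :* E :* (w :* x) := (M :* x) :* (E :* w)) refl M E w (r ℚ.* s) ⟩
  M ℚ.* (r ℚ.* s) ℚ.* (E ℚ.* w)
    ≤⟨ ℚ.*-monoˡ-≤-nonNeg (M ℚ.* (r ℚ.* s)) {{ℚ.nonNegative (0≤* 0≤M 0≤rs)}} Ew≤ ⟩
  M ℚ.* (r ℚ.* s) ℚ.* (u ℚ.+ u ℚ.+ h)
    ≡⟨ solve 5 (λ M r s u h → M :* (r :* s) :* (u :+ u :+ h) :=
         (M :* s :+ M :* s) :* (u :* r) :+ M :* h :* (r :* s)) refl M r s u h ⟩
  (M ℚ.* s ℚ.+ M ℚ.* s) ℚ.* (u ℚ.* r) ℚ.+ M ℚ.* h ℚ.* (r ℚ.* s)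
    ≤⟨ ℚ.+-mono-≤ (ℚ.≤-reflexive (cong ((M ℚ.* s ℚ.+ M ℚ.* s) ℚ.*_) (recip-inverse 0<u)))
         (ℚ.*-monoˡ-≤-nonNeg (M ℚ.* h) {{ℚ.nonNegative (0≤* 0≤M 0≤h)}}
           (*-mono 0≤s (ℚ.nonNegative⁻¹ (1ℚ ℚ.+ 1ℚ)) (recip≤2 ½≤u) (recip≤2 ½≤w))) ⟩
  (M ℚ.* s ℚ.+ M ℚ.* s) ℚ.* 1ℚ ℚ.+ M ℚ.* h ℚ.* ((1ℚ ℚ.+ 1ℚ) ℚ.* (1ℚ ℚ.+ 1ℚ))
    ≡⟨ solve 3 (λ M s h → (M :* s :+ M :* s) :* con 1ℚ :+ M :* h :* ((con 1ℚ :+ con 1ℚ) :* (con 1ℚ :+ con 1ℚ)) :=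
         (M :* s :+ (M :+ M) :* h) :+ (M :* s :+ (M :+ M) :* h)) refl M s h ⟩
  (M ℚ.* s ℚ.+ (M ℚ.+ M) ℚ.* h) ℚ.+ (M ℚ.* s ℚ.+ (M ℚ.+ M) ℚ.* h) ∎)
  where
  open ℚ.≤-Reasoning
  open +-*-Solver
  r s : ℚ
  r = recip u
  s = recip w
  0<u : 0ℚ ℚ.< u
  0<u = ½≤⇒0< ½≤u
  0<w : 0ℚ ℚ.< w
  0<w = ½≤⇒0< ½≤w
  0≤r : 0ℚ ℚ.≤ r
  0≤r = ℚ.<⇒≤ (recip-positive 0<u)
  0≤s : 0ℚ ℚ.≤ s
  0≤s = ℚ.<⇒≤ (recip-positive 0<w)
  0≤rs : 0ℚ ℚ.≤ r ℚ.* s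
  0≤rs = 0≤* 0≤r 0≤s

multiple-vanishes : ∀ {M} → 0ℚ ℚ.≤ M → ∀ ε → 0ℚ ℚ.< ε →
  ∃[ N ] ∀ k → N ≤ k → M ℚ.* 1/[1+ k ] ℚ.≤ ε
multiple-vanishes {M} 0≤M ε 0<ε = N , λ k N≤k → begin
  M ℚ.* 1/[1+ k ]                 ≤⟨ *-mono (ℚ.<⇒≤ 0<1/[1+ k ]) (ℚ.<⇒≤ 0<M+1) (p≤p+q M (ℚ.<⇒≤ 0<1))
                                       (ℚ.≤-trans (1/[1+]-anti N≤k) N-small) ⟩
  (M ℚ.+ 1ℚ) ℚ.* (ε ℚ.* r)        ≡⟨ solve 3 (λ a b c → a :* (b :* c) := b :* (a :* c)) refl (M ℚ.+ 1ℚ) ε r ⟩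
  ε ℚ.* ((M ℚ.+ 1ℚ) ℚ.* r)        ≡⟨ cong (ε ℚ.*_) (recip-inverse 0<M+1) ⟩
  ε ℚ.* 1ℚ                        ≡⟨ ℚ.*-identityʳ ε ⟩
  ε                               ∎
  where
  open ℚ.≤-Reasoning
  open +-*-Solver
  0<1 : 0ℚ ℚ.< 1ℚ
  0<1 = ℚ.positive⁻¹ 1ℚ
  0<M+1 : 0ℚ ℚ.< M ℚ.+ 1ℚ
  0<M+1 = ℚ.+-mono-≤-< 0≤M 0<1
  r : ℚ
  -- M may be 0, so the tolerance is ε/(M + 1) rather than ε/M.
  r = recip (M ℚ.+ 1ℚ)
  small : ∃[ N ] 1/[1+ N ] ℚ.≤ ε ℚ.* r
  small = archimedean (ε ℚ.* r) (ℚ.positive⁻¹ (ε ℚ.* r)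
    {{ℚ.pos*pos⇒pos ε {{ℚ.positive 0<ε}} r {{ℚ.positive (recip-positive 0<M+1)}}}})
  N : ℕ
  N = proj₁ small
  N-small : 1/[1+ N ] ℚ.≤ ε ℚ.* r
  N-small = proj₂ small

-- Passage from Riemann sums to the reals

theorem3p3 : (a b : ℕ) .{{_ : NonZero a}} .{{_ : NonZero b}} →
    Coprime a b → (a , b) ≢ (1 , 1) →
    (ψ : 𝒯) (ψ∈ : ψ ∈𝒯[ a , b ]) →
    Independent ψ (+ a) (+ b) →
    let c = a + b in
    fromℕ c /ᴿ log c ≤ᴿ fromℕ (rad (a * b * c)) *ᴿ (fromℕ ‖ ψ∈ ‖ /ᴿ log 2)
theorem3p3 a b a⊥b _ ψ ψ∈ W≢0 ε 0<ε = N , λ k N≤k → begin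
  -- Products and reciprocals of reals are formed termwise, so this is the k-th term of the left
  -- side.
  ι c ℚ.* recip (logSum c k)
    ≤⟨ quotient-bound {ι c} {M} {ι e} 0≤M (ℚ.<⇒≤ 0<1/[1+ k ]) (½≤logSum c 2≤c k) (½≤logSum 2 ≤-refl k)
         2C≤ME (2^≤square⇒logSum e c {{c≢0}} 2^e≤c² k) ⟩
  M ℚ.* recip (logSum 2 k) ℚ.+ (M ℚ.+ M) ℚ.* 1/[1+ k ]
    -- The slack ε allowed by `_≤ᴿ_` absorbs the mesh error 2 M/(k+1) for k ≥ N.
    ≤⟨ ℚ.+-mono-≤ (ℚ.≤-reflexive (ℚ.*-assoc (ι R) (ι K) (recip (logSum 2 k)))) (small k N≤k) ⟩
  ι R ℚ.* (ι K ℚ.* recip (logSum 2 k)) ℚ.+ ε ∎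
  where
  open ℚ.≤-Reasoning
  c R K : ℕ
  c = a + b
  R = rad (a * b * c)
  K = ‖ ψ∈ ‖
  M : ℚ
  M = ι R ℚ.* ι K
  exponent : ∃[ e ] 2 ^ e ≤ c * c × 2 * c ≤ R * K * e
  exponent = Ω-exponent-bound a b a⊥b ψ∈ W≢0
  e : ℕ
  e = proj₁ exponent
  2^e≤c² : 2 ^ e ≤ c * c
  2^e≤c² = proj₁ (proj₂ exponent)
  2c≤RKe : 2 * c ≤ R * K * e
  2c≤RKe = proj₂ (proj₂ exponent)
  2≤c : 2 ≤ c
  2≤c = +-mono-≤ (>-nonZero⁻¹ a) (>-nonZero⁻¹ b)
  c≢0 : NonZero c
  c≢0 = >-nonZero (<⇒≤ 2≤c)
  0≤M : 0ℚ ℚ.≤ M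
  0≤M = 0≤* (0≤ι R) (0≤ι K)
  2C≤ME : ι c ℚ.+ ι c ℚ.≤ M ℚ.* ι e
  2C≤ME = begin
    ι c ℚ.+ ι c               ≡⟨ ι-+ c c ⟨
    ι (c + c)                 ≡⟨ cong (λ z → ι (c + z)) (+-identityʳ c) ⟨
    ι (2 * c)                 ≤⟨ ι-mono 2c≤RKe ⟩
    ι (R * K * e)             ≡⟨ ι-* (R * K) e ⟩
    ι (R * K) ℚ.* ι e         ≡⟨ cong (ℚ._* ι e) (ι-* R K) ⟩
    M ℚ.* ι e                 ∎
  vanishing : ∃[ N ] ∀ k → N ≤ k → (M ℚ.+ M) ℚ.* 1/[1+ k ] ℚ.≤ ε
  vanishing = multiple-vanishes (ℚ.+-mono-≤ 0≤M 0≤M) ε 0<ε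
  N : ℕ
  N = proj₁ vanishing
  small : ∀ k → N ≤ k → (M ℚ.+ M) ℚ.* 1/[1+ k ] ℚ.≤ ε
  small = proj₂ vanishing
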